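{- Let $D$ be an $\mathrm{STS}_2(v)$ on $\mathbb{F}_2^v$ with an automorphism $A$ of order $3$. Then $A$ has type $A_{v,f}$ with $f\not\equiv 2\pmod 3$. If $f\not\equiv v\pmod 3$, then either $v=3$ or $f\le (v-3)/2$.
   Context: An $\mathrm{STS}_2(v)$ on $V=\mathbb{F}_2^v$ is a set of $3$-dimensional subspaces (blocks) of $V$ such that every $2$-dimensional subspace lies in exactly one block. $\mathrm{GL}(v,2)$ acts on subspaces via $\mathbf{x}\mapsto\mathbf{x}A$; an automorphism of $D$ is an $A\in\mathrm{GL}(v,2)$ mapping $D$ to itself. For $f\in\{0,\ldots,v-1\}$ with $v-f$ even, $A_{v,f}$ is the block-diagonal matrix consisting of $\frac{v-f}{2}$ blocks $\begin{pmatrix}0&1\\1&1\end{pmatrix}$ followed by $I_f$; every element of order $3$ in $\mathrm{GL}(v,2)$ is conjugate to exactly one $A_{v,f}$, called its type. -}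

module Defs where

open import Data.Bool using (Bool; true; false; if_then_else_; _xor_; _∧_; not)
open import Data.Nat using (ℕ; _∸_; _/_; _%_; _<ᵇ_; _≡ᵇ_)
open import Data.Fin using (Fin; toℕ)
open import Data.Vec using (Vec; replicate; zipWith; foldr; map; tabulate)
open import Data.Product using (Σ; ∃; _×_)
open import Relation.Binary.PropositionalEquality using (_≡_; _≢_)
open import Relation.Nullary.Decidable using (isYes)
import Data.Fin as F

-- Vectors of F₂^v (row vectors), F₂ = Bool with xor as addition.
Vect : ℕ → Set
Vect v = Vec Bool v

zeroV : ∀ {v} → Vect v
zeroV = replicate _ false

_⊕_ : ∀ {v} → Vect v → Vect v → Vect v
_⊕_ = zipWith _xor_

combo : ∀ {v k} → Vec Bool k → Vec (Vect v) k → Vect v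
combo c b = foldr _ _⊕_ zeroV (zipWith (λ ci r → if ci then r else zeroV) c b)

-- v×v matrices over F₂, given as the list of rows
Mat : ℕ → Set
Mat v = Vec (Vect v) v

_·_ : ∀ {v} → Vect v → Mat v → Vect v
x · A = combo x A

_*_ : ∀ {v} → Mat v → Mat v → Mat v
A * B = map (λ r → r · B) A

I : ∀ {v} → Mat v
I = tabulate (λ i → tabulate (λ j → isYes (i F.≟ j)))

Invertible : ∀ {v} → Mat v → Set
Invertible {v} A = Σ (Mat v) (λ B → (A * B ≡ I) × (B * A ≡ I))

HasOrder3 : ∀ {v} → Mat v → Set
HasOrder3 A = (A ≢ I) × (A * A ≢ I) × (A * (A * A) ≡ I)

Conjugate : ∀ {v} → Mat v → Mat v → Set
Conjugate {v} A T = Σ (Mat v) (λ P → Σ (Mat v) (λ Q →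
  (P * Q ≡ I) × (Q * P ≡ I) × (Q * (A * P) ≡ T)))

-- A_{v,f}: (v-f)/2 blocks [[0,1],[1,1]] on the diagonal, followed by I_f.
typeMat : (v f : ℕ) → Mat v
typeMat v f = tabulate (λ i → tabulate (λ j → entry (toℕ i) (toℕ j)))
  where
  entry : ℕ → ℕ → Bool
  entry i j =
    if (i <ᵇ (v ∸ f)) ∧ (j <ᵇ (v ∸ f))
    then (if (i / 2) ≡ᵇ (j / 2)
          then not (((i % 2) ≡ᵇ 0) ∧ ((j % 2) ≡ᵇ 0))
          else false)
    else (i ≡ᵇ j)

Sub : ℕ → Set₁
Sub v = Vect v → Set

_⊆_ : ∀ {v} → Sub v → Sub v → Set
S ⊆ T = ∀ x → S x → T x

_≐_ : ∀ {v} → Sub v → Sub v → Set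
S ≐ T = (S ⊆ T) × (T ⊆ S)

Span : ∀ {v k} → Vec (Vect v) k → Sub v
Span {k = k} b x = Σ (Vec Bool k) (λ c → combo c b ≡ x)

LinIndep : ∀ {v k} → Vec (Vect v) k → Set
LinIndep {k = k} b = ∀ (c : Vec Bool k) → combo c b ≡ zeroV → c ≡ replicate _ false

IsSubspaceDim : ∀ {v} → ℕ → Sub v → Set
IsSubspaceDim {v} k S = Σ (Vec (Vect v) k) (λ b → LinIndep b × (S ≐ Span b))

IsSTS2 : (v : ℕ) → (Sub v → Set) → Set₁
IsSTS2 v D =
  (∀ B → D B → IsSubspaceDim 3 B) ×
  (∀ U → IsSubspaceDim 2 U →
     Σ (Sub v) (λ B → D B × (U ⊆ B) × (∀ B' → D B' → U ⊆ B' → B' ≐ B)))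

img : ∀ {v} → Mat v → Sub v → Sub v
img A S x = ∃ (λ y → S y × (y · A ≡ x))

IsAut : ∀ {v} → (Sub v → Set) → Mat v → Set₁
IsAut {v} D A =
  Invertible A ×
  (∀ B → D B → Σ (Sub v) (λ B' → D B' × (img A B ≐ B'))) ×
  (∀ B' → D B' → Σ (Sub v) (λ B → D B × (img A B ≐ B')))

{-# OPTIONS --safe #-}
module Submission where

-- Write σ for the action of A, F for its fixed space and W = ker(1 + σ + σ²), so that |F| = 2^f and
-- |W| = 2^(v-f). A block through two fixed points is pointwise fixed, so the blocks inside F
-- partition the pairs of distinct points of F into classes of 42 = 7 · 6, which forces
-- 7 ∣ (2^f - 1)(2^f - 2) and hence f ≢ 2 (mod 3).
--
-- Let p be a fixed point. The blocks through p that are not contained in F partition V \ F, once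
-- 0 and p are removed, into sextuples permuted by σ. If σ stabilises none of them, then
-- 18 ∣ 2^v - 2^f, so 9 ∣ 2^(v-f) - 1 and f ≡ v (mod 3). Otherwise σ stabilises a block through p
-- that contains a line {w, σw, σ²w} of W. This line determines the block, and p is the only fixed
-- point of the block, so if f ≢ v (mod 3) then 3(2^f - 1) ≤ 2^(v-f) - 1. As v is odd
-- (6 ∣ 2^v - 2, counting around one point), so is f, and the bound follows.

open import Defs
open import Data.Bool using (Bool; true; false; if_then_else_; _xor_; _∧_; not)
import Data.Bool.Properties as Bool
open import Data.Fin as F using (Fin; toℕ)
open import Data.List using (List; []; _∷_; _++_; length; map; filter; cartesianProduct)
open import Data.List.Membership.Propositional using (_∈_; _∉_; lose)
open import Data.List.Membership.Propositional.Properties using (∈-++⁺ˡ; ∈-++⁺ʳ; ∈-++⁻; ∈-map⁺; ∈-map⁻; ∈-filter⁺; ∈-filter⁻; ∈-cartesianProduct⁺; ∈-cartesianProduct⁻)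
import Data.List.Membership.DecPropositional as DecMembership
open import Data.List.Properties using (length-++; length-map; length-removeAt′)
open import Data.List.Relation.Binary.Subset.Propositional using () renaming (_⊆_ to _⊑_)
import Data.List.Relation.Unary.All as All
import Data.List.Relation.Unary.All.Properties as All
open import Data.List.Relation.Unary.AllPairs using ([]; _∷_)
open import Data.List.Relation.Unary.Any as Any using (here; there; satisfied; _─_)
open import Data.List.Relation.Unary.Unique.Propositional using (Unique)
import Data.List.Relation.Unary.Unique.Propositional.Properties as Uniq
open import Data.Nat using (ℕ; zero; suc; _<_; _≤_; _+_; _∸_; _^_; _/_; _%_; _<ᵇ_; _≡ᵇ_; z≤n; s≤s; NonZero)
import Data.Nat as ℕ
open import Data.Nat.Coprimality using (coprime?; coprime-divisor)
open import Data.Nat.DivMod using (m≡m%n+[m/n]*n; [m+kn]%n≡m%n; m%n<n; m/n≡1+[m∸n]/n)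
open import Data.Nat.Divisibility using (_∣_; divides; _∣0; ∣-refl; ∣-trans; ∣m∣n⇒∣m+n)
open import Data.Nat.Induction using (<-wellFounded)
open import Data.Nat.Properties using (≤-antisym; ≤-trans; ≤-reflexive; ≰⇒>; <⇒≤; n≮n; _≤?_; suc-injective; +-suc; +-identityʳ; +-cancelˡ-≡; +-monoˡ-≤; +-monoʳ-≤; +-monoˡ-<; *-identityˡ; *-comm; *-assoc; *-distribˡ-+; *-distribʳ-+; *-monoˡ-≤; ^-monoʳ-≤; ^-*-assoc; ^-distribˡ-+-*; m∸n+n≡m; m+n∸n≡m; module ≤-Reasoning)
open import Data.Nat.Tactic.RingSolver using (solve-∀)
open import Data.Product using (Σ; ∃; _×_; _,_; proj₁; proj₂)
import Data.Product.Properties as Product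
open import Data.Sum using (_⊎_; inj₁; inj₂; [_,_]′)
open import Data.Vec as Vec using (Vec; []; _∷_; tabulate)
open import Data.Vec.Properties using (zipWith-assoc; zipWith-comm; zipWith-identityˡ; zipWith-identityʳ; ∷-injective; ∷-injectiveʳ; tabulate-cong; tabulate-∘; ≡-dec)
open import Data.Vec.Relation.Unary.All using (All; []; _∷_)
open import Function using (_∘_)
open import Induction.WellFounded using (Acc; acc)
open import Relation.Binary.Definitions using (DecidableEquality)
open import Relation.Binary.PropositionalEquality using (_≡_; _≢_; ≢-sym; refl; sym; trans; cong; cong₂; subst; subst₂; module ≡-Reasoning)
open import Relation.Nullary using (¬_; Dec; yes; no; ¬?; _×-dec_; contradiction)
open import Relation.Nullary.Decidable using (isYes; from-yes)
open import Relation.Unary using (Decidable)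

private variable
  X Y : Set
  n k : ℕ

-- Counting with duplicate-free lists.

∈-─⁺ : ∀ {x y : X} {ys} (y∈ : y ∈ ys) → x ∈ ys → x ≢ y → x ∈ (ys ─ y∈)
∈-─⁺ (here refl) (here refl) x≢y = contradiction refl x≢y
∈-─⁺ (here refl) (there x∈) x≢y = x∈
∈-─⁺ (there y∈) (here refl) x≢y = here refl
∈-─⁺ (there y∈) (there x∈) x≢y = there (∈-─⁺ y∈ x∈ x≢y)

-- Pigeonhole by deletion: once the occurrence of the head is removed from `ys`, the tail still
-- embeds, because it does not repeat the head.
unique-⊑⇒length-≤ : ∀ {xs ys : List X} → Unique xs → xs ⊑ ys → length xs ≤ length ys
unique-⊑⇒length-≤ {xs = []} _ _ = z≤n
unique-⊑⇒length-≤ {xs = x ∷ xs} {ys} u@(_ ∷ uxs) xs⊑ys =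
  subst (suc (length xs) ≤_) (sym (length-removeAt′ ys _))
    (s≤s (unique-⊑⇒length-≤ uxs λ y∈ →
      ∈-─⁺ (xs⊑ys (here refl)) (xs⊑ys (there y∈)) λ { refl → Uniq.Unique[x∷xs]⇒x∉xs u y∈ }))

unique-⊑⊒⇒length-≡ : ∀ {xs ys : List X} → Unique xs → Unique ys → xs ⊑ ys → ys ⊑ xs →
  length xs ≡ length ys
unique-⊑⊒⇒length-≡ u u′ p q = ≤-antisym (unique-⊑⇒length-≤ u p) (unique-⊑⇒length-≤ u′ q)

length-filter-¬ : ∀ {P : X → Set} (P? : Decidable P) xs →
  length (filter P? xs) + length (filter (¬? ∘ P?) xs) ≡ length xs
length-filter-¬ P? [] = refl
length-filter-¬ P? (x ∷ xs) with P? x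
... | yes _ = cong suc (length-filter-¬ P? xs)
... | no _ = trans (+-suc _ _) (cong suc (length-filter-¬ P? xs))

length-cartesianProduct : ∀ (xs : List X) (ys : List Y) →
  length (cartesianProduct xs ys) ≡ length xs ℕ.* length ys
length-cartesianProduct [] ys = refl
length-cartesianProduct (x ∷ xs) ys =
  trans (length-++ (map (x ,_) ys)) (cong₂ _+_ (length-map _ ys) (length-cartesianProduct xs ys))

-- One half of a double count: the fibres are disjoint because `z` determines `x`, so their
-- concatenation is a duplicate-free list inside `ys`.
fibres-length-≤ : ∀ {k} (S : X → Y → Set) {xs : List X} {ys : List Y} → Unique xs →
  (∀ {x} → x ∈ xs → ∃ λ zs → Unique zs × length zs ≡ k × (∀ {z} → z ∈ zs → S x z × z ∈ ys)) →
  (∀ {x x′ z} → S x z → S x′ z → x ≡ x′) →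
  length xs ℕ.* k ≤ length ys
fibres-length-≤ {X = X} {Y = Y} {k} S {xs₀} {ys} u₀ fibre functional =
  let zs , uzs , len , zs⊑ = collect xs₀ u₀ (λ m → m)
  in subst (_≤ length ys) len (unique-⊑⇒length-≤ uzs (λ z∈ → proj₂ (zs⊑ z∈)))
  where
  collect : ∀ xs → Unique xs → xs ⊑ xs₀ → ∃ λ zs → Unique zs × length zs ≡ length xs ℕ.* k ×
    (∀ {z} → z ∈ zs → (∃ λ x → x ∈ xs × S x z) × z ∈ ys)
  collect [] _ _ = [] , [] , refl , λ ()
  collect (x ∷ xs) u@(_ ∷ uxs) xs⊑ with fibre (xs⊑ (here refl)) | collect xs uxs (xs⊑ ∘ there)
  ... | as , uas , las , as⊑ | bs , ubs , lbs , bs⊑ =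
    as ++ bs , Uniq.++⁺ uas ubs disjoint , trans (length-++ as) (cong₂ _+_ las lbs) , covered
    where
    disjoint : ∀ {z} → ¬ (z ∈ as × z ∈ bs)
    disjoint (z∈as , z∈bs) with bs⊑ z∈bs
    ... | (x′ , x′∈ , s) , _ with functional (proj₁ (as⊑ z∈as)) s
    ... | refl = Uniq.Unique[x∷xs]⇒x∉xs u x′∈
    covered : ∀ {z} → z ∈ as ++ bs → (∃ λ x′ → x′ ∈ x ∷ xs × S x′ z) × z ∈ ys
    covered z∈ with ∈-++⁻ as z∈
    ... | inj₁ z∈as = (x , here refl , proj₁ (as⊑ z∈as)) , proj₂ (as⊑ z∈as)
    ... | inj₂ z∈bs with bs⊑ z∈bs
    ... | (x′ , x′∈ , s) , z∈ys = (x′ , there x′∈ , s) , z∈ys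

module Counting (_≟_ : DecidableEquality X) where

  open DecMembership _≟_ using (_∈?_)

  unique-⊑-length-≥⇒⊒ : ∀ {xs ys : List X} → Unique xs → xs ⊑ ys → length ys ≤ length xs → ys ⊑ xs
  unique-⊑-length-≥⇒⊒ {xs} u xs⊑ys len {y} y∈ with y ∈? xs
  ... | yes y∈xs = y∈xs
  ... | no y∉xs = contradiction (≤-trans
          (unique-⊑⇒length-≤ (All.¬Any⇒All¬ xs y∉xs ∷ u) λ { (here refl) → y∈ ; (there p) → xs⊑ys p })
          len) (n≮n _)

  infixl 6 _∖_
  _∖_ : List X → X → List X
  xs ∖ x = filter (λ y → ¬? (y ≟ x)) xs

  ∈-∖⁺ : ∀ {x y xs} → y ∈ xs → y ≢ x → y ∈ xs ∖ x
  ∈-∖⁺ {x} = ∈-filter⁺ (λ y → ¬? (y ≟ x))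

  ∈-∖⁻ : ∀ {x y} xs → y ∈ xs ∖ x → y ∈ xs × y ≢ x
  ∈-∖⁻ {x} xs = ∈-filter⁻ (λ y → ¬? (y ≟ x)) {xs = xs}

  ∖-unique : ∀ {x xs} → Unique xs → Unique (xs ∖ x)
  ∖-unique = Uniq.filter⁺ _

  length-∖ : ∀ {x xs} → Unique xs → x ∈ xs → suc (length (xs ∖ x)) ≡ length xs
  length-∖ {x} {xs} u x∈ = unique-⊑⊒⇒length-≡
    (All.tabulate (λ y∈ x≡y → proj₂ (∈-∖⁻ xs y∈) (sym x≡y)) ∷ ∖-unique u) u
    (λ { (here refl) → x∈ ; (there y∈) → proj₁ (∈-∖⁻ xs y∈) })
    back
    where
    back : xs ⊑ x ∷ xs ∖ x
    back {y} y∈ with y ≟ x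
    ... | yes refl = here refl
    ... | no y≢x = there (∈-∖⁺ y∈ y≢x)

  distinctPairs : List X → List (X × X)
  distinctPairs xs = filter (λ (x , y) → ¬? (x ≟ y)) (cartesianProduct xs xs)

  ∈-distinctPairs⁺ : ∀ {x y xs} → x ∈ xs → y ∈ xs → x ≢ y → (x , y) ∈ distinctPairs xs
  ∈-distinctPairs⁺ x∈ y∈ = ∈-filter⁺ _ (∈-cartesianProduct⁺ x∈ y∈)

  ∈-distinctPairs⁻ : ∀ {x y} xs → (x , y) ∈ distinctPairs xs → x ∈ xs × y ∈ xs × x ≢ y
  ∈-distinctPairs⁻ xs m =
    let m′ , x≢y = ∈-filter⁻ (λ (x , y) → ¬? (x ≟ y)) {xs = cartesianProduct xs xs} m
        x∈ , y∈ = ∈-cartesianProduct⁻ xs xs m′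
    in x∈ , y∈ , x≢y

  distinctPairs-unique : ∀ {xs} → Unique xs → Unique (distinctPairs xs)
  distinctPairs-unique u = Uniq.filter⁺ _ (Uniq.cartesianProduct⁺ u u)

  -- The diagonal of the square is a copy of `xs`. The additive form avoids truncated subtraction.
  length-distinctPairs : ∀ {xs} → Unique xs →
    length xs + length (distinctPairs xs) ≡ length xs ℕ.* length xs
  length-distinctPairs {xs} u = begin
    length xs + length (distinctPairs xs)
      ≡⟨ cong (_+ length (distinctPairs xs)) (trans (sym (length-map (λ x → x , x) xs)) diagonal) ⟩
    length (filter eq? (cartesianProduct xs xs)) + length (distinctPairs xs)
      ≡⟨ length-filter-¬ eq? (cartesianProduct xs xs) ⟩
    length (cartesianProduct xs xs)
      ≡⟨ length-cartesianProduct xs xs ⟩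
    length xs ℕ.* length xs ∎
    where
    open ≡-Reasoning
    eq? : Decidable (λ ((x , y) : X × X) → x ≡ y)
    eq? (x , y) = x ≟ y
    diagonal : length (map (λ x → x , x) xs) ≡ length (filter eq? (cartesianProduct xs xs))
    diagonal = unique-⊑⊒⇒length-≡ (Uniq.map⁺ (cong proj₁) u)
      (Uniq.filter⁺ eq? (Uniq.cartesianProduct⁺ u u))
      (λ m → let x , x∈ , eq = ∈-map⁻ (λ x → x , x) m in
        subst (_∈ _) (sym eq) (∈-filter⁺ eq? (∈-cartesianProduct⁺ x∈ x∈) refl))
      back
      where
      back : filter eq? (cartesianProduct xs xs) ⊑ map (λ x → x , x) xs
      back {x , y} m with ∈-filter⁻ eq? {xs = cartesianProduct xs xs} m
      ... | m′ , refl = ∈-map⁺ (λ x → x , x) (proj₁ (∈-cartesianProduct⁻ xs xs m′))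

  -- Overlapping classes may list their elements in different orders, so `meet` speaks of membership
  -- rather than of equal lists.
  record Partition (k : ℕ) (cls : X → List X) (xs : List X) : Set where
    field
      unique : ∀ {x} → x ∈ xs → Unique (cls x)
      size   : ∀ {x} → x ∈ xs → length (cls x) ≡ k
      self   : ∀ {x} → x ∈ xs → x ∈ cls x
      within : ∀ {x} → x ∈ xs → cls x ⊑ xs
      meet   : ∀ {x y z} → x ∈ xs → y ∈ xs → z ∈ cls x → z ∈ cls y → y ∈ cls x

  -- The class of the head is split off and the rest is partitioned by the same `cls`. The rest is a
  -- filtered list, hence the recursion on length.
  partition⇒∣ : ∀ {k cls xs} → Unique xs → Partition k cls xs → k ∣ length xs
  partition⇒∣ {k} {cls} {xs₀} u₀ part₀ = go xs₀ (<-wellFounded _) u₀ part₀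
    where
    go : ∀ xs → Acc _<_ (length xs) → Unique xs → Partition k cls xs → k ∣ length xs
    go [] _ _ _ = k ∣0
    go xs@(x ∷ _) (acc rec) u part =
      subst (k ∣_) (length-filter-¬ in? xs)
        (∣m∣n⇒∣m+n (subst (k ∣_) (sym class-size) ∣-refl)
          (go rest (rec rest<) (Uniq.filter⁺ (¬? ∘ in?) u) part′))
      where
      open Partition part
      x∈ : x ∈ xs
      x∈ = here refl
      in? : Decidable (_∈ cls x)
      in? = _∈? cls x
      rest : List X
      rest = filter (¬? ∘ in?) xs
      ∈-rest⁻ : ∀ {y} → y ∈ rest → y ∈ xs × y ∉ cls x
      ∈-rest⁻ = ∈-filter⁻ (¬? ∘ in?) {xs = xs}
      class-size : length (filter in? xs) ≡ k
      class-size = trans (unique-⊑⊒⇒length-≡ (Uniq.filter⁺ in? u) (unique x∈)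
        (λ m → proj₂ (∈-filter⁻ in? {xs = xs} m))
        (λ m → ∈-filter⁺ in? (within x∈ m) m)) (size x∈)
      rest< : length rest < length xs
      rest< = unique-⊑⇒length-≤ {xs = x ∷ rest}
        (All.¬Any⇒All¬ rest (λ m → proj₂ (∈-rest⁻ m) (self x∈)) ∷ Uniq.filter⁺ (¬? ∘ in?) u)
        λ { (here refl) → x∈ ; (there m) → proj₁ (∈-rest⁻ m) }
      part′ : Partition k cls rest
      part′ = record
        { unique = λ m → unique (proj₁ (∈-rest⁻ m))
        ; size = λ m → size (proj₁ (∈-rest⁻ m))
        ; self = λ m → self (proj₁ (∈-rest⁻ m))
        -- If the class of a remaining `y` reached into the removed class, `meet` would place `y`
        -- there as well.
        ; within = λ m z∈ → let y∈ , y∉ = ∈-rest⁻ m in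
            ∈-filter⁺ (¬? ∘ in?) (within y∈ z∈) (λ z∈x → y∉ (meet x∈ y∈ z∈x z∈))
        ; meet = λ m m′ → meet (proj₁ (∈-rest⁻ m)) (proj₁ (∈-rest⁻ m′))
        }

-- Linear algebra over the field with two elements.

_≟ᵥ_ : DecidableEquality (Vect n)
_≟ᵥ_ = ≡-dec Bool._≟_

⊕-assoc : (x y z : Vect n) → (x ⊕ y) ⊕ z ≡ x ⊕ (y ⊕ z)
⊕-assoc = zipWith-assoc Bool.xor-assoc

⊕-comm : (x y : Vect n) → x ⊕ y ≡ y ⊕ x
⊕-comm = zipWith-comm Bool.xor-comm

⊕-identityˡ : (x : Vect n) → zeroV ⊕ x ≡ x
⊕-identityˡ = zipWith-identityˡ Bool.xor-identityˡ

⊕-identityʳ : (x : Vect n) → x ⊕ zeroV ≡ x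
⊕-identityʳ = zipWith-identityʳ Bool.xor-identityʳ

⊕-self : (x : Vect n) → x ⊕ x ≡ zeroV
⊕-self [] = refl
⊕-self (a ∷ x) = cong₂ _∷_ (Bool.xor-same a) (⊕-self x)

⊕-cancelˡ : (x y : Vect n) → x ⊕ (x ⊕ y) ≡ y
⊕-cancelˡ x y = trans (sym (⊕-assoc x x y)) (trans (cong (_⊕ y) (⊕-self x)) (⊕-identityˡ y))

⊕-injectiveˡ : (x : Vect n) {y z : Vect n} → x ⊕ y ≡ x ⊕ z → y ≡ z
⊕-injectiveˡ x {y} {z} e = trans (sym (⊕-cancelˡ x y)) (trans (cong (x ⊕_) e) (⊕-cancelˡ x z))

⊕≡0⇒≡ : {x y : Vect n} → x ⊕ y ≡ zeroV → x ≡ y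
⊕≡0⇒≡ {x = x} e = sym (⊕-injectiveˡ x (trans e (sym (⊕-self x))))

⊕-interchange : (a b c d : Vect n) → (a ⊕ b) ⊕ (c ⊕ d) ≡ (a ⊕ c) ⊕ (b ⊕ d)
⊕-interchange a b c d = begin
  (a ⊕ b) ⊕ (c ⊕ d) ≡⟨ ⊕-assoc a b (c ⊕ d) ⟩
  a ⊕ (b ⊕ (c ⊕ d)) ≡⟨ cong (a ⊕_) (⊕-assoc b c d) ⟨
  a ⊕ ((b ⊕ c) ⊕ d) ≡⟨ cong (λ t → a ⊕ (t ⊕ d)) (⊕-comm b c) ⟩
  a ⊕ ((c ⊕ b) ⊕ d) ≡⟨ cong (a ⊕_) (⊕-assoc c b d) ⟩
  a ⊕ (c ⊕ (b ⊕ d)) ≡⟨ ⊕-assoc a c (b ⊕ d) ⟨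
  (a ⊕ c) ⊕ (b ⊕ d) ∎
  where open ≡-Reasoning

Additive : (Vect n → Vect k) → Set
Additive f = ∀ x y → f (x ⊕ y) ≡ f x ⊕ f y

additive-0 : {f : Vect n → Vect k} → Additive f → f zeroV ≡ zeroV
additive-0 {f = f} add = begin
  f zeroV               ≡⟨ cong f (⊕-self zeroV) ⟨
  f (zeroV ⊕ zeroV)     ≡⟨ add zeroV zeroV ⟩
  f zeroV ⊕ f zeroV     ≡⟨ ⊕-self (f zeroV) ⟩
  zeroV                 ∎
  where open ≡-Reasoning

combo-⊕ : (b : Vec (Vect n) k) → Additive (λ c → combo c b)
combo-⊕ [] [] [] = sym (⊕-self zeroV)
combo-⊕ (r ∷ b) (s ∷ c) (t ∷ d) = begin
  scale (s xor t) ⊕ combo (c ⊕ d) b                ≡⟨ cong₂ _⊕_ (scale-xor s t) (combo-⊕ b c d) ⟩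
  (scale s ⊕ scale t) ⊕ (combo c b ⊕ combo d b)    ≡⟨ ⊕-interchange _ _ _ _ ⟩
  (scale s ⊕ combo c b) ⊕ (scale t ⊕ combo d b)    ∎
  where
  open ≡-Reasoning
  scale : Bool → Vect _
  scale a = if a then r else zeroV
  scale-xor : ∀ a b → scale (a xor b) ≡ scale a ⊕ scale b
  scale-xor false b = sym (⊕-identityˡ _)
  scale-xor true false = sym (⊕-identityʳ _)
  scale-xor true true = sym (⊕-self _)

-- Coefficients are only 0 and 1, so additivity already makes `f` linear. With `f` the right
-- multiplication by a matrix, this becomes associativity of the product.
combo-map : ∀ {m} {f : Vect n → Vect m} → Additive f → (c : Vec Bool k) (b : Vec (Vect n) k) →
  combo c (Vec.map f b) ≡ f (combo c b)
combo-map add [] [] = sym (additive-0 add)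
combo-map {f = f} add (false ∷ c) (r ∷ b) =
  trans (⊕-identityˡ _) (trans (combo-map add c b) (cong f (sym (⊕-identityˡ _))))
combo-map {f = f} add (true ∷ c) (r ∷ b) =
  trans (cong (f r ⊕_) (combo-map add c b)) (sym (add r _))

·-* : (x : Vect n) (A B : Mat n) → x · (A * B) ≡ (x · A) · B
·-* x A B = combo-map (combo-⊕ B) x A

tabulate-false : ∀ {n} {g : Fin n → Bool} → (∀ i → g i ≡ false) → tabulate g ≡ zeroV
tabulate-false {zero} e = refl
tabulate-false {suc n} e = cong₂ _∷_ (e F.zero) (tabulate-false (λ i → e (F.suc i)))

I-suc : I {suc n} ≡ (true ∷ zeroV) ∷ Vec.map (false ∷_) I
I-suc {n} = cong₂ _∷_ (cong (true ∷_) (tabulate-false {n} λ _ → refl))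
  (trans (tabulate-cong λ i → cong (false ∷_) (tabulate-cong (isYes-suc i)))
         (tabulate-∘ (false ∷_) (λ i → tabulate (λ j → isYes (i F.≟ j)))))
  where
  isYes-suc : ∀ {n} (i j : Fin n) → isYes (F.suc i F.≟ F.suc j) ≡ isYes (i F.≟ j)
  isYes-suc i j with i F.≟ j
  ... | yes _ = refl
  ... | no _ = refl

·-I : (x : Vect n) → x · I ≡ x
·-I [] = refl
·-I {suc n} (a ∷ x) = begin
  combo (a ∷ x) I                                  ≡⟨ cong (combo (a ∷ x)) I-suc ⟩
  (if a then true ∷ zeroV else zeroV) ⊕ combo x (Vec.map (false ∷_) I)
    ≡⟨ cong ((if a then true ∷ zeroV else zeroV) ⊕_) (trans (combo-map (λ _ _ → refl) x I) (cong (false ∷_) (·-I x))) ⟩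
  (if a then true ∷ zeroV else zeroV) ⊕ (false ∷ x) ≡⟨ head-add a ⟩
  a ∷ x                                            ∎
  where
  open ≡-Reasoning
  head-add : ∀ a → (if a then true ∷ zeroV else zeroV) ⊕ (false ∷ x) ≡ a ∷ x
  head-add true = cong (true ∷_) (⊕-identityˡ x)
  head-add false = cong (false ∷_) (⊕-identityˡ x)

allVect : ∀ n → List (Vect n)
allVect zero = [] ∷ []
allVect (suc n) = map (false ∷_) (allVect n) ++ map (true ∷_) (allVect n)

∈-allVect : (x : Vect n) → x ∈ allVect n
∈-allVect [] = here refl
∈-allVect (false ∷ x) = ∈-++⁺ˡ (∈-map⁺ _ (∈-allVect x))
∈-allVect (true ∷ x) = ∈-++⁺ʳ _ (∈-map⁺ _ (∈-allVect x))

allVect-unique : ∀ n → Unique (allVect n)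
allVect-unique zero = All.[] ∷ []
allVect-unique (suc n) = Uniq.++⁺ (Uniq.map⁺ ∷-injectiveʳ (allVect-unique n))
  (Uniq.map⁺ ∷-injectiveʳ (allVect-unique n)) disjoint
  where
  disjoint : ∀ {x} → x ∈ map (false ∷_) (allVect n) × x ∈ map (true ∷_) (allVect n) → _
  disjoint (p , q) with ∈-map⁻ (false ∷_) p | ∈-map⁻ (true ∷_) q
  ... | _ , _ , refl | _ , _ , ()

length-allVect : ∀ n → length (allVect n) ≡ 2 ^ n
length-allVect zero = refl
length-allVect (suc n) = trans (length-++ (map (false ∷_) (allVect n)))
  (cong₂ _+_ (half false) (trans (half true) (sym (+-identityʳ _))))
  where
  half : ∀ a → length (map (a ∷_) (allVect n)) ≡ 2 ^ n
  half a = trans (length-map _ (allVect n)) (length-allVect n)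

-- Independent pairs, spans, and blocks as lists.

Ind : ∀ {v} → Vect v → Vect v → Set
Ind x y = x ≢ zeroV × y ≢ zeroV × x ≢ y

ind? : ∀ {v} (x y : Vect v) → Dec (Ind x y)
ind? x y = ¬? (x ≟ᵥ zeroV) ×-dec ¬? (y ≟ᵥ zeroV) ×-dec ¬? (x ≟ᵥ y)

-- Over two scalars, a nontrivial relation between two vectors says that one of them is zero or that
-- they are equal.
ind⇒linIndep : ∀ {v} {x y : Vect v} → Ind x y → LinIndep (x ∷ y ∷ [])
ind⇒linIndep _ (false ∷ false ∷ []) _ = refl
ind⇒linIndep {y = y} (_ , y≢0 , _) (false ∷ true ∷ []) e =
  contradiction (trans (sym (trans (⊕-identityˡ _) (⊕-identityʳ y))) e) y≢0
ind⇒linIndep {x = x} (x≢0 , _) (true ∷ false ∷ []) e =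
  contradiction (trans (sym (trans (cong (x ⊕_) (⊕-identityˡ _)) (⊕-identityʳ x))) e) x≢0
ind⇒linIndep {x = x} {y} (_ , _ , x≢y) (true ∷ true ∷ []) e =
  contradiction (⊕≡0⇒≡ (trans (cong (x ⊕_) (sym (⊕-identityʳ y))) e)) x≢y

module _ {v k} (b : Vec (Vect v) k) where

  spanList : List (Vect v)
  spanList = map (λ c → combo c b) (allVect k)

  ∈-spanList⁺ : ∀ c → combo c b ∈ spanList
  ∈-spanList⁺ c = ∈-map⁺ (λ c → combo c b) (∈-allVect c)

  ∈-spanList⁻ : ∀ {u} → u ∈ spanList → Span b u
  ∈-spanList⁻ u∈ = let c , _ , e = ∈-map⁻ (λ c → combo c b) {xs = allVect k} u∈ in c , sym e

  spanList-unique : LinIndep b → Unique spanList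
  spanList-unique indep = Uniq.map⁺ (λ {c} {d} e → ⊕≡0⇒≡ (indep (c ⊕ d)
    (trans (combo-⊕ b c d) (trans (cong (_⊕ combo d b) e) (⊕-self (combo d b))))))
    (allVect-unique k)

  length-spanList : length spanList ≡ 2 ^ k
  length-spanList = trans (length-map _ (allVect k)) (length-allVect k)

linIndep-∷ : ∀ {v k} {b : Vec (Vect v) k} {u} → LinIndep b → ¬ Span b u → LinIndep (u ∷ b)
linIndep-∷ indep _ (false ∷ c) e = cong (false ∷_) (indep c (trans (sym (⊕-identityˡ _)) e))
linIndep-∷ indep u∉ (true ∷ c) e = contradiction (c , sym (⊕≡0⇒≡ e)) u∉

combo-∈ : ∀ {v k} {xs : List (Vect v)} → zeroV ∈ xs →
  (∀ {z w} → z ∈ xs → w ∈ xs → (z ⊕ w) ∈ xs) →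
  ∀ c {b : Vec (Vect v) k} → All (_∈ xs) b → combo c b ∈ xs
combo-∈ 0∈ ⊕∈ [] [] = 0∈
combo-∈ 0∈ ⊕∈ (true ∷ c) (r∈ ∷ b∈) = ⊕∈ r∈ (combo-∈ 0∈ ⊕∈ c b∈)
combo-∈ 0∈ ⊕∈ (false ∷ c) (r∈ ∷ b∈) = ⊕∈ 0∈ (combo-∈ 0∈ ⊕∈ c b∈)

-- The data of an STS₂(v) that the counting needs: blk x y lists the eight vectors of the block
-- through an independent pair x, y (its value on dependent pairs is irrelevant).
record Steiner {v} (σ : Vect v → Vect v) : Set where
  field
    blk    : Vect v → Vect v → List (Vect v)
    unique : ∀ {x y} → Ind x y → Unique (blk x y)
    size   : ∀ {x y} → Ind x y → length (blk x y) ≡ 8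
    zero∈  : ∀ {x y} → Ind x y → zeroV ∈ blk x y
    left∈  : ∀ {x y} → Ind x y → x ∈ blk x y
    right∈ : ∀ {x y} → Ind x y → y ∈ blk x y
    ⊕∈     : ∀ {x y z w} → Ind x y → z ∈ blk x y → w ∈ blk x y → (z ⊕ w) ∈ blk x y
    blk-⊑  : ∀ {x y z w} → Ind x y → Ind z w → z ∈ blk x y → w ∈ blk x y → blk x y ⊑ blk z w
    σ∈     : ∀ {x y u} → Ind x y → u ∈ blk x y → σ u ∈ blk (σ x) (σ y)

module _ {v} {D : Sub v → Set} (sts : IsSTS2 v D) where

  private
    record Listing (B : Sub v) (elements : List (Vect v)) : Set where
      field
        unique   : Unique elements
        size     : length elements ≡ 8
        zero∈    : zeroV ∈ elements
        ⊕∈       : ∀ {z w} → z ∈ elements → w ∈ elements → (z ⊕ w) ∈ elements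
        sound    : ∀ {u} → u ∈ elements → B u
        complete : ∀ {u} → B u → u ∈ elements

    -- A basis turns the bare predicate `B` into a list of 2³ = 8 vectors, on which membership is
    -- decidable.
    listing : ∀ {B} → D B → ∃ (Listing B)
    listing {B} B∈D with proj₁ sts B B∈D
    ... | b , indep , B⊆ , ⊆B = spanList b , record
      { unique = spanList-unique b indep
      ; size = length-spanList b
      ; zero∈ = subst (_∈ spanList b) (additive-0 (combo-⊕ b)) (∈-spanList⁺ b zeroV)
      ; ⊕∈ = λ z∈ w∈ → let c , z≡ = ∈-spanList⁻ b z∈ ; d , w≡ = ∈-spanList⁻ b w∈ in
          subst (_∈ spanList b) (trans (combo-⊕ b c d) (cong₂ _⊕_ z≡ w≡)) (∈-spanList⁺ b (c ⊕ d))
      ; sound = λ u∈ → ⊆B _ (∈-spanList⁻ b u∈)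
      ; complete = λ Bu → let c , e = B⊆ _ Bu in subst (_∈ spanList b) e (∈-spanList⁺ b c)
      }

    span⊆ : ∀ {B z w} → D B → B z → B w → Span (z ∷ w ∷ []) ⊆ B
    span⊆ B∈D Bz Bw _ (c , refl) = sound (combo-∈ zero∈ ⊕∈ c (complete Bz ∷ complete Bw ∷ []))
      where open Listing (proj₂ (listing B∈D))

    block : ∀ {x y} → Ind x y → Σ (Sub v) λ B → D B × B x × B y
    block {x} {y} i with proj₂ sts (Span (x ∷ y ∷ [])) (x ∷ y ∷ [] , ind⇒linIndep i , (λ _ s → s) , (λ _ s → s))
    ... | B , B∈D , U⊆B , _ = B , B∈D ,
      U⊆B x (true ∷ false ∷ [] , trans (cong (x ⊕_) (⊕-identityˡ _)) (⊕-identityʳ x)) ,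
      U⊆B y (false ∷ true ∷ [] , trans (⊕-identityˡ _) (⊕-identityʳ y))

    -- Each of the two blocks contains the line spanned by `z` and `w`, so each agrees with the one
    -- block through that line.
    block-unique : ∀ {B B′ z w} → D B → D B′ → Ind z w → B z → B w → B′ z → B′ w → B ⊆ B′
    block-unique {B} {B′} {z} {w} d d′ i Bz Bw B′z B′w u Bu
      with proj₂ sts (Span (z ∷ w ∷ [])) (z ∷ w ∷ [] , ind⇒linIndep i , (λ _ s → s) , (λ _ s → s))
    ... | _ , _ , _ , only = proj₂ (only B′ d′ (span⊆ d′ B′z B′w)) u (proj₁ (only B d (span⊆ d Bz Bw)) u Bu)

    blk : Vect v → Vect v → List (Vect v)
    blk x y with ind? x y
    ... | yes i = proj₁ (listing (proj₁ (proj₂ (block i))))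
    ... | no _ = []

    record Spec (x y : Vect v) : Set₁ where
      field
        {B}     : Sub v
        B∈D     : D B
        Bx      : B x
        By      : B y
        listed  : Listing B (blk x y)
      open Listing listed public

    spec : ∀ {x y} → Ind x y → Spec x y
    -- `blk x y` runs its own test `ind? x y`; the recorded equation `eq` ties it to the proof `j`,
    -- so that both refer to the same chosen block.
    spec {x} {y} i with ind? x y in eq
    ... | no ¬i = contradiction i ¬i
    ... | yes j = let B , B∈D , Bx , By = block j in record
      { B∈D = B∈D ; Bx = Bx ; By = By
      ; listed = subst (Listing B) (sym (blk-yes eq)) (proj₂ (listing B∈D)) }
      where
      blk-yes : ∀ {j} → ind? x y ≡ yes j → blk x y ≡ proj₁ (listing (proj₁ (proj₂ (block j))))
      blk-yes e with ind? x y | e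
      ... | _ | refl = refl

  steiner : ∀ {A} → IsAut D A → (∀ {x y} → x · A ≡ y · A → x ≡ y) → Steiner (_· A)
  steiner {A} (_ , image , _) injective = record
    { blk = blk
    ; unique = λ i → Spec.unique (spec i)
    ; size = λ i → Spec.size (spec i)
    ; zero∈ = λ i → Spec.zero∈ (spec i)
    ; left∈ = λ i → Spec.complete (spec i) (Spec.Bx (spec i))
    ; right∈ = λ i → Spec.complete (spec i) (Spec.By (spec i))
    ; ⊕∈ = λ i → Spec.⊕∈ (spec i)
    ; blk-⊑ = λ i j z∈ w∈ u∈ → let open Spec in complete (spec j)
        (block-unique (B∈D (spec i)) (B∈D (spec j)) j
          (sound (spec i) z∈) (sound (spec i) w∈) (Bx (spec j)) (By (spec j)) _ (sound (spec i) u∈))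
    ; σ∈ = σ∈
    }
    where
    ind-· : ∀ {x y} → Ind x y → Ind (x · A) (y · A)
    ind-· (x≢0 , y≢0 , x≢y) = ≢0 x≢0 , ≢0 y≢0 , (x≢y ∘ injective)
      where
      ≢0 : ∀ {x} → x ≢ zeroV → x · A ≢ zeroV
      ≢0 x≢0 e = x≢0 (injective (trans e (sym (additive-0 (combo-⊕ A)))))
    σ∈ : ∀ {x y u} → Ind x y → u ∈ blk x y → (u · A) ∈ blk (x · A) (y · A)
    -- The image of the block lies in some `B′` of `D`, which shares the independent pair `x · A`,
    -- `y · A` with the block listed there.
    σ∈ {x} {y} {u} i u∈ with image _ (Spec.B∈D (spec i))
    ... | B′ , B′∈D , img⊆ , _ = let open Spec in complete (spec (ind-· i))
      (block-unique B′∈D (B∈D (spec (ind-· i))) (ind-· i)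
        (moved x (Bx (spec i))) (moved y (By (spec i)))
        (Bx (spec (ind-· i))) (By (spec (ind-· i))) _ (moved u (sound (spec i) u∈)))
      where
      moved : ∀ z → Spec.B (spec i) z → B′ (z · A)
      moved z Bz = img⊆ _ (z , Bz , refl)

-- Blocks under a linear map of order three.

module OrderThree {v} (σ : Vect v → Vect v) (σ-⊕ : Additive σ)
  (σ³ : ∀ x → σ (σ (σ x)) ≡ x) (S : Steiner σ) where

  open Steiner S
  open Counting (_≟ᵥ_ {v})
  open DecMembership (_≟ᵥ_ {v}) using (_∈?_)
  module Pairs = Counting (Product.≡-dec (_≟ᵥ_ {v}) (_≟ᵥ_ {v}))

  Fixed : Vect v → Set
  Fixed x = σ x ≡ x

  fixed? : Decidable Fixed
  fixed? x = σ x ≟ᵥ x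

  fixedVectors movedVectors : List (Vect v)
  fixedVectors = filter fixed? (allVect v)
  movedVectors = filter (¬? ∘ fixed?) (allVect v)

  σ-injective : ∀ {x y} → σ x ≡ σ y → x ≡ y
  σ-injective {x} {y} e = trans (sym (σ³ x)) (trans (cong (σ ∘ σ) e) (σ³ y))

  σ-0 : Fixed zeroV
  σ-0 = additive-0 σ-⊕

  fixed-σ⁻ : ∀ {x} → Fixed (σ x) → Fixed x
  fixed-σ⁻ = σ-injective

  -- By `blk-⊑`, `x` and `y` lie in the block of `z` and `w`, so `blk-⊑` applies again with the two
  -- pairs exchanged.
  blk-⊒ : ∀ {x y z w} → Ind x y → Ind z w → z ∈ blk x y → w ∈ blk x y → blk z w ⊑ blk x y
  blk-⊒ i j z∈ w∈ = blk-⊑ j i (blk-⊑ i j z∈ w∈ (left∈ i)) (blk-⊑ i j z∈ w∈ (right∈ i))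

  fixed-combo : ∀ {x y} → Fixed x → Fixed y → ∀ c → Fixed (combo c (x ∷ y ∷ []))
  fixed-combo {x} {y} fx fy c = trans (sym (combo-map σ-⊕ c (x ∷ y ∷ [])))
    (cong₂ (λ x y → combo c (x ∷ y ∷ [])) fx fy)

  -- For u outside the line L = ⟨x, y⟩ the block is L ∪ (u + L); if σu = u + s with s ∈ L fixed,
  -- then σ²u = u, which together with σ³ = 1 forces σu = u.
  fixed-blk : ∀ {x y u} → Ind x y → Fixed x → Fixed y → u ∈ blk x y → Fixed u
  fixed-blk {x} {y} {u} i fx fy u∈ with u ∈? spanList (x ∷ y ∷ [])
  ... | yes u∈L = let c , e = ∈-spanList⁻ (x ∷ y ∷ []) u∈L in subst Fixed e (fixed-combo fx fy c)
  ... | no u∉L = conclude (∈-spanList⁻ b (exhaust σu∈))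
    where
    b : Vec (Vect v) 3
    b = u ∷ x ∷ y ∷ []
    σu∈ : σ u ∈ blk x y
    σu∈ = subst₂ (λ x y → σ u ∈ blk x y) fx fy (σ∈ i u∈)
    -- The span of `b` consists of 2³ = 8 vectors of a block that has only eight.
    exhaust : blk x y ⊑ spanList b
    exhaust = unique-⊑-length-≥⇒⊒
      (spanList-unique b (linIndep-∷ (ind⇒linIndep i)
        λ { (c , e) → u∉L (subst (_∈ _) e (∈-spanList⁺ _ c)) }))
      (λ m → let c , e = ∈-spanList⁻ b m in subst (_∈ blk x y) e
        (combo-∈ (zero∈ i) (⊕∈ i) c (u∈ ∷ left∈ i ∷ right∈ i ∷ [])))
      (≤-reflexive (trans (size i) (sym (length-spanList b))))
    conclude : Span b (σ u) → Fixed u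
    -- Coefficient `false` at `u` puts `σ u` on the line, where everything is fixed; then `u` is
    -- fixed too.
    conclude (false ∷ c , e) =
      fixed-σ⁻ (subst Fixed (trans (sym (⊕-identityˡ _)) e) (fixed-combo fx fy c))
    conclude (true ∷ c , e) = trans (sym (cong σ σ²u)) (σ³ u)
      where
      open ≡-Reasoning
      s : Vect v
      s = combo c (x ∷ y ∷ [])
      σ²u : σ (σ u) ≡ u
      σ²u = begin
        σ (σ u)     ≡⟨ cong σ e ⟨
        σ (u ⊕ s)   ≡⟨ σ-⊕ u s ⟩
        σ u ⊕ σ s   ≡⟨ cong₂ _⊕_ (sym e) (fixed-combo fx fy c) ⟩
        (u ⊕ s) ⊕ s ≡⟨ ⊕-comm _ s ⟩
        s ⊕ (u ⊕ s) ≡⟨ cong (s ⊕_) (⊕-comm u s) ⟩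
        s ⊕ (s ⊕ u) ≡⟨ ⊕-cancelˡ s u ⟩
        u           ∎

  -- The class of `x` for the relation of lying in a common block with `p`; it has 8 - 2 = 6
  -- elements.
  cls : Vect v → Vect v → List (Vect v)
  cls p x = blk p x ∖ zeroV ∖ p

  ∈-cls⁺ : ∀ {p x y} → y ∈ blk p x → y ≢ zeroV → y ≢ p → y ∈ cls p x
  ∈-cls⁺ y∈ y≢0 = ∈-∖⁺ (∈-∖⁺ y∈ y≢0)

  ∈-cls⁻ : ∀ {p x y} → Ind p x → y ∈ cls p x → y ∈ blk p x × Ind p y
  ∈-cls⁻ {p} {x} (p≢0 , _) m =
    let m′ , y≢p = ∈-∖⁻ (blk p x ∖ zeroV) m
        y∈ , y≢0 = ∈-∖⁻ (blk p x) m′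
    in y∈ , p≢0 , y≢0 , ≢-sym y≢p

  cls-unique : ∀ {p x} → Ind p x → Unique (cls p x)
  cls-unique i = ∖-unique (∖-unique (unique i))

  cls-size : ∀ {p x} → Ind p x → length (cls p x) ≡ 6
  cls-size i@(p≢0 , _) = suc-injective (suc-injective (trans
    (cong suc (length-∖ (∖-unique (unique i)) (∈-∖⁺ (left∈ i) p≢0)))
    (trans (length-∖ (unique i) (zero∈ i)) (size i))))

  cls-self : ∀ {p x} → Ind p x → x ∈ cls p x
  cls-self i@(_ , x≢0 , p≢x) = ∈-cls⁺ (right∈ i) x≢0 (≢-sym p≢x)

  -- `z` is independent of `p`, so both blocks are the block through `p` and `z`.
  cls-meet : ∀ {p x y z} → Ind p x → Ind p y → z ∈ cls p x → z ∈ cls p y → y ∈ cls p x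
  cls-meet ix iy@(_ , y≢0 , p≢y) zx zy =
    let z∈x , iz = ∈-cls⁻ ix zx ; z∈y , _ = ∈-cls⁻ iy zy in
    ∈-cls⁺ (blk-⊒ ix iz (left∈ ix) z∈x (blk-⊑ iy iz (left∈ iy) z∈y (right∈ iy))) y≢0 (≢-sym p≢y)

  -- The blocks through `p` cut the other 2^v - 2 nonzero vectors into sextuples. This later makes
  -- `v` odd.
  6∣nonzero∖p : ∀ {p} → p ≢ zeroV → 6 ∣ length (allVect v ∖ zeroV ∖ p)
  6∣nonzero∖p {p} p≢0 = partition⇒∣ {cls = cls p} (∖-unique (∖-unique (allVect-unique v))) record
    { unique = cls-unique ∘ ind
    ; size = cls-size ∘ ind
    ; self = cls-self ∘ ind
    ; within = λ x∈ y∈ → let _ , _ , y≢0 , p≢y = ∈-cls⁻ (ind x∈) y∈ in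
        ∈-∖⁺ (∈-∖⁺ (∈-allVect _) y≢0) (≢-sym p≢y)
    ; meet = λ x∈ y∈ → cls-meet (ind x∈) (ind y∈)
    }
    where
    ind : ∀ {x} → x ∈ allVect v ∖ zeroV ∖ p → Ind p x
    ind m = let m′ , x≢p = ∈-∖⁻ (allVect v ∖ zeroV) m
                _ , x≢0 = ∈-∖⁻ (allVect v) m′
            in p≢0 , x≢0 , ≢-sym x≢p

  fixedPairs : List (Vect v × Vect v)
  fixedPairs = distinctPairs (fixedVectors ∖ zeroV)

  fixedVectors-unique : Unique fixedVectors
  fixedVectors-unique = Uniq.filter⁺ fixed? (allVect-unique v)

  ∈-fixed∖0⁻ : ∀ {x} → x ∈ fixedVectors ∖ zeroV → Fixed x × x ≢ zeroV
  ∈-fixed∖0⁻ m = let m′ , x≢0 = ∈-∖⁻ fixedVectors m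
                 in proj₂ (∈-filter⁻ fixed? {xs = allVect v} m′) , x≢0

  -- With ordered pairs a whole block serves as a class, contributing 7 · 6 pairs; `fixed-blk` keeps
  -- a class that starts in F inside F.
  42∣fixedPairs : 42 ∣ length fixedPairs
  42∣fixedPairs = Pairs.partition⇒∣ {cls = pcls}
    (distinctPairs-unique (∖-unique fixedVectors-unique)) record
    { unique = λ m → distinctPairs-unique (∖-unique (unique (ind m)))
    ; size = λ m → pcls-size (ind m)
    ; self = λ m → let i@(x≢0 , y≢0 , x≢y) = ind m in
        ∈-distinctPairs⁺ (∈-∖⁺ (left∈ i) x≢0) (∈-∖⁺ (right∈ i) y≢0) x≢y
    ; within = λ m m′ → let z∈ , w∈ , z≢0 , w≢0 , z≢w = ∈-pcls⁻ m′ in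
        ∈-distinctPairs⁺ (fixed∈ m z∈ z≢0) (fixed∈ m w∈ w≢0) z≢w
    ; meet = λ m m′ p p′ →
        let z∈ , w∈ , j = ∈-pcls⁻ p
            z∈′ , w∈′ , _ = ∈-pcls⁻ p′
            i = ind m
            i′@(x≢0 , y≢0 , x≢y) = ind m′
            move = λ {u} (u∈ : u ∈ _) → blk-⊒ i j z∈ w∈ (blk-⊑ i′ j z∈′ w∈′ u∈)
        in ∈-distinctPairs⁺ (∈-∖⁺ (move (left∈ i′)) x≢0) (∈-∖⁺ (move (right∈ i′)) y≢0) x≢y
    }
    where
    pcls : Vect v × Vect v → List (Vect v × Vect v)
    pcls (x , y) = distinctPairs (blk x y ∖ zeroV)
    ind : ∀ {x y} → (x , y) ∈ fixedPairs → Ind x y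
    ind m = let x∈ , y∈ , x≢y = ∈-distinctPairs⁻ (fixedVectors ∖ zeroV) m
            in proj₂ (∈-fixed∖0⁻ x∈) , proj₂ (∈-fixed∖0⁻ y∈) , x≢y
    ∈-pcls⁻ : ∀ {x y z w} → (z , w) ∈ pcls (x , y) → z ∈ blk x y × w ∈ blk x y × Ind z w
    ∈-pcls⁻ {x} {y} m =
      let z∈ , w∈ , z≢w = ∈-distinctPairs⁻ (blk x y ∖ zeroV) m
          z∈′ , z≢0 = ∈-∖⁻ (blk x y) z∈
          w∈′ , w≢0 = ∈-∖⁻ (blk x y) w∈
      in z∈′ , w∈′ , z≢0 , w≢0 , z≢w
    pcls-size : ∀ {x y} → Ind x y → length (pcls (x , y)) ≡ 42
    -- The seven nonzero vectors of a block give 7 + P = 7 · 7, hence P = 42.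
    pcls-size {x} {y} i = +-cancelˡ-≡ 7 _ _ (subst
      (λ k → k ℕ.+ length (pcls (x , y)) ≡ k ℕ.* k)
      (suc-injective (trans (length-∖ (unique i) (zero∈ i)) (size i)))
      (length-distinctPairs (∖-unique (unique i))))
    fixed∈ : ∀ {x y z} → (x , y) ∈ fixedPairs → z ∈ blk x y → z ≢ zeroV →
      z ∈ fixedVectors ∖ zeroV
    fixed∈ m z∈ z≢0 =
      let x∈ , y∈ , _ = ∈-distinctPairs⁻ (fixedVectors ∖ zeroV) m
      in ∈-∖⁺ (∈-filter⁺ fixed? (∈-allVect _)
           (fixed-blk (ind m) (proj₁ (∈-fixed∖0⁻ x∈)) (proj₁ (∈-fixed∖0⁻ y∈)) z∈)) z≢0

  -- `free` says that σ keeps no sextuple of moved vectors in place. As σ³ = 1, these sextuples are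
  -- permuted in cycles of length three, of 3 · 6 vectors each.
  18∣movedVectors : ∀ {p} → p ≢ zeroV → Fixed p → (∀ {x} → ¬ Fixed x → σ x ∉ blk p x) →
    18 ∣ length movedVectors
  18∣movedVectors {p} p≢0 fp free = partition⇒∣ {cls = orbit}
    (Uniq.filter⁺ (¬? ∘ fixed?) (allVect-unique v)) record
    { unique = orbit-unique ∘ moved
    ; size = orbit-size ∘ moved
    ; self = λ m → ∈-++⁺ˡ (cls-self (ind (moved m)))
    ; within = λ {x} m u∈ → ∈-filter⁺ (¬? ∘ fixed?) (∈-allVect _) (orbit-moved (moved m) u∈)
    ; meet = λ m m′ → orbit-meet (moved m) (moved m′)
    }
    where
    orbit : Vect v → List (Vect v)
    orbit x = cls p x ++ cls p (σ x) ++ cls p (σ (σ x))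

    moved : ∀ {x} → x ∈ movedVectors → ¬ Fixed x
    moved m = proj₂ (∈-filter⁻ (¬? ∘ fixed?) {xs = allVect v} m)

    moved-σ : ∀ {x} → ¬ Fixed x → ¬ Fixed (σ x)
    moved-σ m = m ∘ fixed-σ⁻

    ind : ∀ {x} → ¬ Fixed x → Ind p x
    ind m = p≢0 , (λ { refl → m σ-0 }) , (λ { refl → m fp })

    -- An overlap would put `σ x` into the block of `p` and `x`, against `free`.
    separate : ∀ {x z} → ¬ Fixed x → z ∈ cls p x → z ∉ cls p (σ x)
    separate m z∈ z∈′ = free m
      (proj₁ (∈-cls⁻ (ind m) (cls-meet (ind m) (ind (moved-σ m)) z∈ z∈′)))

    orbit-unique : ∀ {x} → ¬ Fixed x → Unique (orbit x)
    orbit-unique {x} m = Uniq.++⁺ (cls-unique (ind m))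
      (Uniq.++⁺ (cls-unique (ind (moved-σ m))) (cls-unique (ind (moved-σ (moved-σ m))))
        λ (z∈ , z∈′) → separate (moved-σ m) z∈ z∈′)
      λ (z∈ , z∈′) → [ separate m z∈
                     -- By `σ³` the first class is the successor of the third, so `separate` applies
                     -- cyclically.
                     , (λ z∈″ → separate (moved-σ (moved-σ m)) z∈″ (subst (λ y → _ ∈ cls p y) (sym (σ³ x)) z∈))
                     ]′ (∈-++⁻ (cls p (σ x)) z∈′)

    orbit-size : ∀ {x} → ¬ Fixed x → length (orbit x) ≡ 18
    orbit-size {x} m = trans (length-++ (cls p x)) (cong₂ ℕ._+_ (cls-size (ind m))
      (trans (length-++ (cls p (σ x)))
        (cong₂ ℕ._+_ (cls-size (ind (moved-σ m))) (cls-size (ind (moved-σ (moved-σ m)))))))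

    -- Hides which of the three classes contains `u`, so that later arguments treat the three cases
    -- at once.
    data InOrbit (x u : Vect v) : Set where
      in-cls : ∀ {y} → ¬ Fixed y → u ∈ cls p y → cls p y ⊑ orbit x → InOrbit x u

    inOrbit : ∀ {x u} → ¬ Fixed x → u ∈ orbit x → InOrbit x u
    inOrbit {x} m u∈ with ∈-++⁻ (cls p x) u∈
    ... | inj₁ q = in-cls m q ∈-++⁺ˡ
    ... | inj₂ q with ∈-++⁻ (cls p (σ x)) q
    ... | inj₁ r = in-cls (moved-σ m) r (∈-++⁺ʳ (cls p x) ∘ ∈-++⁺ˡ)
    ... | inj₂ r = in-cls (moved-σ (moved-σ m)) r (∈-++⁺ʳ (cls p x) ∘ ∈-++⁺ʳ (cls p (σ x)))

    -- Together with `p`, a fixed `u` would make the whole block fixed by `fixed-blk`, including its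
    -- moved representative.
    orbit-moved : ∀ {x u} → ¬ Fixed x → u ∈ orbit x → ¬ Fixed u
    orbit-moved m u∈ fu with inOrbit m u∈
    ... | in-cls m′ u∈′ _ = let u∈blk , i = ∈-cls⁻ (ind m′) u∈′ in
      m′ (fixed-blk i fp fu (blk-⊑ (ind m′) i (left∈ (ind m′)) u∈blk (right∈ (ind m′))))

    σ-cls : ∀ {x u} → ¬ Fixed x → u ∈ cls p x → σ u ∈ cls p (σ x)
    σ-cls {x} {u} m u∈ = let u∈blk , _ , u≢0 , p≢u = ∈-cls⁻ (ind m) u∈ in
      ∈-cls⁺ (subst (λ q → σ u ∈ blk q (σ x)) fp (σ∈ (ind m) u∈blk))
        (λ e → u≢0 (σ-injective (trans e (sym σ-0))))
        (λ e → p≢u (σ-injective (trans fp (sym e))))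

    σ-orbit : ∀ {x u} → ¬ Fixed x → u ∈ orbit x → σ u ∈ orbit x
    σ-orbit {x} m u∈ with ∈-++⁻ (cls p x) u∈
    ... | inj₁ q = ∈-++⁺ʳ (cls p x) (∈-++⁺ˡ (σ-cls m q))
    ... | inj₂ q with ∈-++⁻ (cls p (σ x)) q
    ... | inj₁ r = ∈-++⁺ʳ (cls p x) (∈-++⁺ʳ (cls p (σ x)) (σ-cls (moved-σ m) r))
    ... | inj₂ r = ∈-++⁺ˡ (subst (λ y → _ ∈ cls p y) (σ³ x) (σ-cls (moved-σ (moved-σ m)) r))

    orbit-absorb : ∀ {x y z} → ¬ Fixed x → ¬ Fixed y → z ∈ orbit x → z ∈ cls p y → y ∈ orbit x
    orbit-absorb m m′ z∈ z∈′ with inOrbit m z∈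
    ... | in-cls m″ z∈″ sub = sub (cls-meet (ind m″) (ind m′) z∈″ z∈′)

    orbit-meet : ∀ {x y z} → ¬ Fixed x → ¬ Fixed y → z ∈ orbit x → z ∈ orbit y → y ∈ orbit x
    orbit-meet {x} {y} m m′ z∈ z∈′ with ∈-++⁻ (cls p y) z∈′
    ... | inj₁ q = orbit-absorb m m′ z∈ q
    ... | inj₂ q with ∈-++⁻ (cls p (σ y)) q
    -- Here `σ y` is in the orbit of `x`, which is stable under σ; two more applications lead back
    -- to `y`.
    ... | inj₁ r = subst (_∈ orbit x) (σ³ y)
      (σ-orbit m (σ-orbit m (orbit-absorb m (moved-σ m′) z∈ r)))
    ... | inj₂ r = subst (_∈ orbit x) (σ³ y)
      (σ-orbit m (orbit-absorb m (moved-σ (moved-σ m′)) z∈ r))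

  -- W = ker (1 + σ + σ²).
  InW : Vect v → Set
  InW z = σ (σ z) ≡ z ⊕ σ z

  InW-σ : ∀ {z} → InW z → InW (σ z)
  InW-σ {z} e = trans (cong σ e) (σ-⊕ z (σ z))

  -- On fixed vectors 1 + σ + σ² is multiplication by 3 = 1, so F and W meet only in 0.
  InW-fixed : ∀ {z} → InW z → Fixed z → z ≡ zeroV
  InW-fixed {z} e fz = begin
    z         ≡⟨ fz ⟨
    σ z       ≡⟨ cong σ fz ⟨
    σ (σ z)   ≡⟨ e ⟩
    z ⊕ σ z   ≡⟨ cong (z ⊕_) fz ⟩
    z ⊕ z     ≡⟨ ⊕-self z ⟩
    zeroV     ∎
    where open ≡-Reasoning

  -- In characteristic 2, (1 + σ + σ²)(1 + σ) = 1 + σ³ = 0.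
  InW-⊕σ : ∀ x → InW (x ⊕ σ x)
  InW-⊕σ x = begin
    σ (σ (x ⊕ σ x))                   ≡⟨ cong σ (σ-⊕ x (σ x)) ⟩
    σ (σ x ⊕ σ (σ x))                 ≡⟨ σ-⊕ _ _ ⟩
    σ (σ x) ⊕ σ (σ (σ x))             ≡⟨ cong (σ (σ x) ⊕_) (σ³ x) ⟩
    σ (σ x) ⊕ x                       ≡⟨ ⊕-comm _ x ⟩
    x ⊕ σ (σ x)                       ≡⟨ cong (x ⊕_) (⊕-cancelˡ (σ x) _) ⟨
    x ⊕ (σ x ⊕ (σ x ⊕ σ (σ x)))       ≡⟨ ⊕-assoc x (σ x) _ ⟨
    (x ⊕ σ x) ⊕ (σ x ⊕ σ (σ x))       ≡⟨ cong ((x ⊕ σ x) ⊕_) (σ-⊕ x (σ x)) ⟨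
    (x ⊕ σ x) ⊕ σ (x ⊕ σ x)           ∎
    where open ≡-Reasoning

  -- An invariant block B through p that is not fixed pointwise contains x + σx for each moved
  -- x ∈ B, hence a line of W, and such a line determines p as the only fixed point of B.
  fixed∖0*3≤ : ∀ {ws} → (∀ {z} → InW z → z ≢ zeroV → z ∈ ws) →
    (∀ {p} → p ≢ zeroV → Fixed p → ∃ λ x → ¬ Fixed x × σ x ∈ blk p x) →
    length (fixedVectors ∖ zeroV) ℕ.* 3 ≤ length ws
  fixed∖0*3≤ {ws} covers invariant = fibres-length-≤ Through (∖-unique fixedVectors-unique) fibre functional
    where
    -- The incidence relation of the double count: every `p` gets three vectors `z`, and every `z`
    -- belongs to at most one `p`.
    Through : Vect v → Vect v → Set
    Through p z = Fixed p × p ≢ zeroV × z ≢ zeroV × InW z × p ∈ blk z (σ z)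

    ind : ∀ {z} → z ≢ zeroV → InW z → Ind z (σ z)
    ind z≢0 z∈W = z≢0 , (λ e → z≢0 (σ-injective (trans e (sym σ-0)))) ,
      λ e → z≢0 (InW-fixed z∈W (sym e))

    through-σ : ∀ {p z} → Through p z → Through p (σ z)
    through-σ {p} {z} (fp , p≢0 , z≢0 , z∈W , p∈) =
      fp , p≢0 , proj₁ (proj₂ (ind z≢0 z∈W)) , InW-σ z∈W ,
      subst (_∈ blk (σ z) (σ (σ z))) fp (σ∈ (ind z≢0 z∈W) p∈)

    functional : ∀ {p q z} → Through p z → Through q z → p ≡ q
    functional {p} {q} (fp , p≢0 , z≢0 , z∈W , p∈) (fq , q≢0 , _ , _ , q∈) with p ≟ᵥ q
    ... | yes p≡q = p≡q
    -- Two fixed points would generate the block, so `z` would be fixed as well as in W, hence zero.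
    ... | no p≢q = contradiction (InW-fixed z∈W (fixed-blk j fp fq (blk-⊑ i j p∈ q∈ (left∈ i)))) z≢0
      where
      i = ind z≢0 z∈W
      j = p≢0 , q≢0 , p≢q

    fibre : ∀ {p} → p ∈ fixedVectors ∖ zeroV → ∃ λ zs → Unique zs × length zs ≡ 3 ×
      (∀ {z} → z ∈ zs → Through p z × z ∈ ws)
    fibre {p} p∈ with ∈-fixed∖0⁻ p∈
    ... | fp , p≢0 with invariant p≢0 fp
    -- Since `w` is in W, these are the three nonzero vectors of the line through `w` and `σ w`.
    ... | x , mx , σx∈ = w ∷ σ w ∷ σ (σ w) ∷ [] ,
      ((w≢σw All.∷ w≢σ²w All.∷ All.[]) ∷ ((w≢σw ∘ σ-injective) All.∷ All.[]) ∷ All.[] ∷ []) , refl ,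
      λ { (here refl) → both through
        ; (there (here refl)) → both (through-σ through)
        ; (there (there (here refl))) → both (through-σ (through-σ through)) }
      where
      w : Vect v
      w = x ⊕ σ x
      w≢0 : w ≢ zeroV
      w≢0 e = mx (sym (⊕≡0⇒≡ e))
      i : Ind p x
      i = p≢0 , (λ { refl → mx σ-0 }) , (λ { refl → mx fp })
      iσ : Ind p (σ x)
      iσ = p≢0 , (λ e → proj₁ (proj₂ i) (σ-injective (trans e (sym σ-0)))) ,
        λ e → proj₂ (proj₂ i) (σ-injective (trans fp e))
      j : Ind w (σ w)
      j = ind w≢0 (InW-⊕σ x)
      w≢σw : w ≢ σ w
      w≢σw = proj₂ (proj₂ j)
      w≢σ²w : w ≢ σ (σ w)
      w≢σ²w e = w≢σw (trans (sym (σ³ w)) (cong σ (sym e)))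
      -- Applying σ to `σx∈` lands in the block of `p = σ p` and `σ x`, which is again the block of
      -- `p` and `x`.
      σ²x∈ : σ (σ x) ∈ blk p x
      σ²x∈ = blk-⊒ i iσ (left∈ i) σx∈ (subst (λ q → σ (σ x) ∈ blk q (σ x)) fp (σ∈ i σx∈))
      w∈ : w ∈ blk p x
      w∈ = ⊕∈ i (right∈ i) σx∈
      σw∈ : σ w ∈ blk p x
      σw∈ = subst (_∈ blk p x) (sym (σ-⊕ x (σ x))) (⊕∈ i σx∈ σ²x∈)
      through : Through p w
      through = fp , p≢0 , w≢0 , InW-⊕σ x , blk-⊑ i j w∈ σw∈ (left∈ i)
      both : ∀ {z} → Through p z → Through p z × z ∈ ws
      both t@(_ , _ , z≢0 , z∈W , _) = t , covers z∈W z≢0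

-- The standard matrix: its action, fixed vectors and kernel W.

-- The entries of typeMat v f, as a function of k = v ∸ f.
entry : ℕ → ℕ → ℕ → Bool
entry k i j =
  if (i <ᵇ k) ∧ (j <ᵇ k)
  then (if (i / 2) ≡ᵇ (j / 2) then not (((i % 2) ≡ᵇ 0) ∧ ((j % 2) ≡ᵇ 0)) else false)
  else (i ≡ᵇ j)

-- Division runs with an accumulator and does not unfold to a successor here, whereas the remainder
-- of `2 + n` modulo 2 reduces by itself.
[2+n]/2 : ∀ n → suc (suc n) / 2 ≡ suc (n / 2)
[2+n]/2 n = m/n≡1+[m∸n]/n {suc (suc n)} {2} (s≤s (s≤s z≤n))

entry-2+ : ∀ k i j → entry (2 + k) (2 + i) (2 + j) ≡ entry k i j
entry-2+ k i j rewrite [2+n]/2 i | [2+n]/2 j = refl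

entry-02+ : ∀ k j → entry (2 + k) 0 (2 + j) ≡ false
entry-02+ k j rewrite [2+n]/2 j with j <ᵇ k
... | true = refl
... | false = refl

entry-12+ : ∀ k j → entry (2 + k) 1 (2 + j) ≡ false
entry-12+ k j rewrite [2+n]/2 j with j <ᵇ k
... | true = refl
... | false = refl

entry-2+0 : ∀ k i → entry (2 + k) (2 + i) 0 ≡ false
entry-2+0 k i rewrite [2+n]/2 i with i <ᵇ k
... | true = refl
... | false = refl

entry-2+1 : ∀ k i → entry (2 + k) (2 + i) 1 ≡ false
entry-2+1 k i rewrite [2+n]/2 i with i <ᵇ k
... | true = refl
... | false = refl

entries : ∀ {n} → ℕ → Mat n
entries k = tabulate λ i → tabulate λ j → entry k (toℕ i) (toℕ j)

-- Splitting off the leading diagonal block allows induction on the number of blocks.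
entries-2+ : ∀ {n} k → entries {2 + n} (2 + k) ≡
  (false ∷ true ∷ zeroV) ∷ (true ∷ true ∷ zeroV) ∷ Vec.map (λ r → false ∷ false ∷ r) (entries k)
entries-2+ {n} k = cong₂ _∷_ (cong (λ r → false ∷ true ∷ r) (tabulate-false λ j → entry-02+ k (toℕ j)))
  (cong₂ _∷_ (cong (λ r → true ∷ true ∷ r) (tabulate-false λ j → entry-12+ k (toℕ j)))
    (trans (tabulate-cong λ i → cong₂ _∷_ (entry-2+0 k (toℕ i)) (cong₂ _∷_ (entry-2+1 k (toℕ i))
        (tabulate-cong λ j → entry-2+ k (toℕ i) (toℕ j))))
      (tabulate-∘ {n = n} (λ r → false ∷ false ∷ r) (λ i → tabulate λ j → entry k (toℕ i) (toℕ j)))))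

entries-0 : ∀ {n} → entries {n} 0 ≡ I
entries-0 = tabulate-cong λ i → tabulate-cong λ j → ≡ᵇ-isYes i j
  where
  ≡ᵇ-isYes : ∀ {n} (i j : Fin n) → (toℕ i ≡ᵇ toℕ j) ≡ isYes (i F.≟ j)
  ≡ᵇ-isYes F.zero F.zero = refl
  ≡ᵇ-isYes F.zero (F.suc j) = refl
  ≡ᵇ-isYes (F.suc i) F.zero = refl
  ≡ᵇ-isYes (F.suc i) (F.suc j) with i F.≟ j | ≡ᵇ-isYes i j
  ... | yes _ | e = e
  ... | no _ | e = e

module _ {f : ℕ} where

  -- Each of the first `m` pairs of coordinates is a copy of the field with four elements, on which
  -- the block multiplies by a primitive cube root of unity.
  act : ∀ m → Vect (m ℕ.* 2 + f) → Vect (m ℕ.* 2 + f)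
  act zero x = x
  act (suc m) (a ∷ b ∷ x) = b ∷ (a xor b) ∷ act m x

  ·-entries : ∀ m x → x · entries (m ℕ.* 2) ≡ act m x
  ·-entries zero x = trans (cong (x ·_) entries-0) (·-I x)
  ·-entries (suc m) (a ∷ b ∷ x) = begin
    (a ∷ b ∷ x) · entries (suc m ℕ.* 2)
      ≡⟨ cong ((a ∷ b ∷ x) ·_) (entries-2+ (m ℕ.* 2)) ⟩
    row a (false ∷ true ∷ zeroV) ⊕ (row b (true ∷ true ∷ zeroV) ⊕ combo x (Vec.map pad (entries (m ℕ.* 2))))
      ≡⟨ cong (λ t → row a (false ∷ true ∷ zeroV) ⊕ (row b (true ∷ true ∷ zeroV) ⊕ t))
           (trans (combo-map (λ _ _ → refl) x (entries (m ℕ.* 2))) (cong pad (·-entries m x))) ⟩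
    row a (false ∷ true ∷ zeroV) ⊕ (row b (true ∷ true ∷ zeroV) ⊕ pad (act m x))
      ≡⟨ add a b (act m x) ⟩
    b ∷ (a xor b) ∷ act m x ∎
    where
    open ≡-Reasoning
    pad : ∀ {n} → Vect n → Vect (2 + n)
    pad r = false ∷ false ∷ r
    row : ∀ {n} → Bool → Vect n → Vect n
    row a r = if a then r else zeroV
    add : ∀ {n} a b (y : Vect n) → row a (false ∷ true ∷ zeroV) ⊕ (row b (true ∷ true ∷ zeroV) ⊕ pad y) ≡
      b ∷ (a xor b) ∷ y
    add true true y = cong (λ r → true ∷ false ∷ r) (trans (⊕-identityˡ _) (⊕-identityˡ y))
    add true false y = cong (λ r → false ∷ true ∷ r) (trans (⊕-identityˡ _) (⊕-identityˡ y))
    add false true y = cong (λ r → true ∷ true ∷ r) (trans (⊕-identityˡ _) (⊕-identityˡ y))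
    add false false y = cong (λ r → false ∷ false ∷ r) (trans (⊕-identityˡ _) (⊕-identityˡ y))

  ·-typeMat : ∀ m x → x · typeMat (m ℕ.* 2 + f) f ≡ act m x
  ·-typeMat m x = trans (cong (λ k → x · entries k) (m+n∸n≡m (m ℕ.* 2) f)) (·-entries m x)

  embedFix : ∀ m → Vect f → Vect (m ℕ.* 2 + f)
  embedFix zero y = y
  embedFix (suc m) y = false ∷ false ∷ embedFix m y

  embedFix-injective : ∀ m {x y} → embedFix m x ≡ embedFix m y → x ≡ y
  embedFix-injective zero e = e
  embedFix-injective (suc m) e = embedFix-injective m (proj₂ (∷-injective (proj₂ (∷-injective e))))

  act-embedFix : ∀ m y → act m (embedFix m y) ≡ embedFix m y
  act-embedFix zero y = refl
  act-embedFix (suc m) y = cong (λ r → false ∷ false ∷ r) (act-embedFix m y)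

  act-fixed : ∀ m x → act m x ≡ x → ∃ λ y → x ≡ embedFix m y
  act-fixed zero x _ = x , refl
  act-fixed (suc m) (a ∷ b ∷ x) e with ∷-injective e
  -- The first coordinate forces `b = a`, the second `a xor a = a`, so both are `false`.
  ... | refl , e′ with a | ∷-injective e′
  ... | true | () , _
  ... | false | _ , e″ = let y , x≡ = act-fixed m x e″ in y , cong (λ r → false ∷ false ∷ r) x≡

  embedW : ∀ m → Vect (m ℕ.* 2) → Vect (m ℕ.* 2 + f)
  embedW zero _ = zeroV
  embedW (suc m) (a ∷ b ∷ y) = a ∷ b ∷ embedW m y

  embedW-0 : ∀ m → embedW m zeroV ≡ zeroV
  embedW-0 zero = refl
  embedW-0 (suc m) = cong (λ r → false ∷ false ∷ r) (embedW-0 m)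

  -- On each pair the condition holds automatically, as the cube root satisfies 1 + ω + ω² = 0. On
  -- the last `f` coordinates it reads x = x + x, that is x = 0.
  act-W : ∀ m x → act m (act m x) ≡ x ⊕ act m x → ∃ λ y → x ≡ embedW m y
  act-W zero x e = [] , trans e (⊕-self x)
  act-W (suc m) (a ∷ b ∷ x) e =
    let y , x≡ = act-W m x (proj₂ (∷-injective (proj₂ (∷-injective e))))
    in a ∷ b ∷ y , cong (λ r → a ∷ b ∷ r) x≡

-- Residues of powers of two.

even⊎odd : ∀ n → (∃ λ h → n ≡ h ℕ.* 2) ⊎ (∃ λ h → n ≡ suc (h ℕ.* 2))
even⊎odd zero = inj₁ (0 , refl)
even⊎odd (suc n) with even⊎odd n
... | inj₁ (h , refl) = inj₂ (h , refl)
... | inj₂ (h , refl) = inj₁ (suc h , refl)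

-- Used for powers of 4, 8 and 64, which are 1 modulo 3, 7 and 63.
[1+d]^q : ∀ d q → ∃ λ t → suc d ^ q ≡ 1 + t ℕ.* d
[1+d]^q d zero = 0 , refl
[1+d]^q d (suc q) = let t , e = [1+d]^q d q in
  1 + t + t ℕ.* d , trans (cong (suc d ℕ.*_) e) (expand d t)
  where
  expand : ∀ d t → suc d ℕ.* (1 + t ℕ.* d) ≡ 1 + (1 + t + t ℕ.* d) ℕ.* d
  expand = solve-∀

-- Congruences are kept as subtraction-free equations; two different numerical remainders then
-- refute them by computation.
residue-≡ : ∀ {a b} n k l .{{_ : NonZero n}} → a + k ℕ.* n ≡ b + l ℕ.* n → a % n ≡ b % n
residue-≡ {a} {b} n k l e =
  trans (sym ([m+kn]%n≡m%n a k n)) (trans (cong (_% n) e) ([m+kn]%n≡m%n b l n))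

-- For even `v`, 2^v is a power of 4 and so 1 modulo 3, while `e` makes it 2 modulo 3.
6∣2^v∸2⇒odd : ∀ {v n} → 6 ∣ n → 2 + n ≡ 2 ^ v → ∃ λ h → v ≡ suc (h ℕ.* 2)
6∣2^v∸2⇒odd {v} (divides c refl) e with even⊎odd v
... | inj₂ odd = odd
... | inj₁ (h , refl) with [1+d]^q 3 h
... | t , e′ = contradiction (residue-≡ {2} {1} 3 (c ℕ.* 2) t (begin
    2 + c ℕ.* 2 ℕ.* 3   ≡⟨ cong (2 +_) (*-assoc c 2 3) ⟩
    2 + c ℕ.* 6         ≡⟨ e ⟩
    2 ^ (h ℕ.* 2)       ≡⟨ cong (2 ^_) (*-comm h 2) ⟩
    2 ^ (2 ℕ.* h)       ≡⟨ ^-*-assoc 2 2 h ⟨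
    4 ^ h               ≡⟨ e′ ⟩
    1 + t ℕ.* 3         ∎)) λ ()
  where open ≡-Reasoning

-- If f = 3q + 2, then 2^f = 4 · 8^q gives N = 3 + 28t. Modulo 7 the left side N + P is 3, but N² is
-- 9, that is 2.
42∣pairs⇒f%3≢2 : ∀ {f N P} → suc N ≡ 2 ^ f → N + P ≡ N ℕ.* N → 42 ∣ P → f % 3 ≢ 2
42∣pairs⇒f%3≢2 {f} {N} eN eP (divides c refl) f%3≡2 with [1+d]^q 7 (f / 3)
... | t , e = contradiction (residue-≡ {3} {2} 7 (c ℕ.* 6 + t ℕ.* 4) (1 + t ℕ.* 24 + t ℕ.* t ℕ.* 112) (begin
    3 + (c ℕ.* 6 + t ℕ.* 4) ℕ.* 7                ≡⟨ lhs c t ⟩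
    3 + t ℕ.* 28 + c ℕ.* 42                      ≡⟨ subst (λ N → N + c ℕ.* 42 ≡ N ℕ.* N) N≡ eP ⟩
    (3 + t ℕ.* 28) ℕ.* (3 + t ℕ.* 28)            ≡⟨ rhs t ⟩
    2 + (1 + t ℕ.* 24 + t ℕ.* t ℕ.* 112) ℕ.* 7   ∎)) λ ()
  where
  open ≡-Reasoning
  lhs : ∀ c t → 3 + (c ℕ.* 6 + t ℕ.* 4) ℕ.* 7 ≡ 3 + t ℕ.* 28 + c ℕ.* 42
  lhs = solve-∀
  rhs : ∀ t → (3 + t ℕ.* 28) ℕ.* (3 + t ℕ.* 28) ≡ 2 + (1 + t ℕ.* 24 + t ℕ.* t ℕ.* 112) ℕ.* 7
  rhs = solve-∀
  four : ∀ t → 4 ℕ.* (1 + t ℕ.* 7) ≡ 4 + t ℕ.* 28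
  four = solve-∀
  N≡ : N ≡ 3 + t ℕ.* 28
  N≡ = suc-injective (begin
    suc N                       ≡⟨ eN ⟩
    2 ^ f                       ≡⟨ cong (2 ^_) (trans (m≡m%n+[m/n]*n f 3) (cong (_+ f / 3 ℕ.* 3) f%3≡2)) ⟩
    2 ^ (2 + f / 3 ℕ.* 3)       ≡⟨ ^-distribˡ-+-* 2 2 (f / 3 ℕ.* 3) ⟩
    4 ℕ.* 2 ^ (f / 3 ℕ.* 3)     ≡⟨ cong (λ k → 4 ℕ.* 2 ^ k) (*-comm (f / 3) 3) ⟩
    4 ℕ.* 2 ^ (3 ℕ.* (f / 3))   ≡⟨ cong (4 ℕ.*_) (^-*-assoc 2 3 (f / 3)) ⟨
    4 ℕ.* 8 ^ (f / 3)           ≡⟨ cong (4 ℕ.*_) e ⟩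
    4 ℕ.* (1 + t ℕ.* 7)         ≡⟨ four t ⟩
    4 + t ℕ.* 28                ∎)

9∣2^n*t⇒9∣t : ∀ n {t} → 9 ∣ 2 ^ n ℕ.* t → 9 ∣ t
9∣2^n*t⇒9∣t zero {t} d = subst (9 ∣_) (*-identityˡ t) d
9∣2^n*t⇒9∣t (suc n) {t} d = 9∣2^n*t⇒9∣t n
  (coprime-divisor (from-yes (coprime? 9 2)) (subst (9 ∣_) (*-assoc 2 (2 ^ n) t) d))

-- M = 2^f (4^m - 1), and 9 is prime to 2, so 9 divides 4^m - 1. The order of 4 modulo 9 is 3; hence
-- 3 divides m, and v - f = 2m is 0 modulo 3.
18∣2^v∸2^f⇒≡ : ∀ m {f M} → 2 ^ f + M ≡ 2 ^ (m ℕ.* 2 + f) → 18 ∣ M → f % 3 ≡ (m ℕ.* 2 + f) % 3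
18∣2^v∸2^f⇒≡ m {f} {M} e 18∣M with [1+d]^q 3 m | [1+d]^q 63 (m / 3)
... | t , e₄ | s , e₆₄ with 9∣2^n*t⇒9∣t f {t ℕ.* 3} (subst (9 ∣_) M≡ (∣-trans (divides 2 refl) 18∣M))
  where
  open ≡-Reasoning
  expand : ∀ a t → (1 + t ℕ.* 3) ℕ.* a ≡ a + a ℕ.* (t ℕ.* 3)
  expand = solve-∀
  M≡ : M ≡ 2 ^ f ℕ.* (t ℕ.* 3)
  M≡ = +-cancelˡ-≡ (2 ^ f) _ _ (begin
    2 ^ f + M                        ≡⟨ e ⟩
    2 ^ (m ℕ.* 2 + f)                ≡⟨ ^-distribˡ-+-* 2 (m ℕ.* 2) f ⟩
    2 ^ (m ℕ.* 2) ℕ.* 2 ^ f          ≡⟨ cong (λ k → 2 ^ k ℕ.* 2 ^ f) (*-comm m 2) ⟩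
    2 ^ (2 ℕ.* m) ℕ.* 2 ^ f          ≡⟨ cong (ℕ._* 2 ^ f) (^-*-assoc 2 2 m) ⟨
    4 ^ m ℕ.* 2 ^ f                  ≡⟨ cong (ℕ._* 2 ^ f) e₄ ⟩
    (1 + t ℕ.* 3) ℕ.* 2 ^ f          ≡⟨ expand (2 ^ f) t ⟩
    2 ^ f + 2 ^ f ℕ.* (t ℕ.* 3)      ∎)
... | divides c e₉ = by-residue (m % 3) (m%n<n m 3) (m≡m%n+[m/n]*n m 3)
  where
  open ≡-Reasoning
  4^m : ∀ r → m ≡ r + m / 3 ℕ.* 3 → 4 ^ r ℕ.* (1 + s ℕ.* 63) ≡ 1 + c ℕ.* 9
  4^m r m≡ = begin
    4 ^ r ℕ.* (1 + s ℕ.* 63)        ≡⟨ cong (4 ^ r ℕ.*_) e₆₄ ⟨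
    4 ^ r ℕ.* 64 ^ (m / 3)          ≡⟨ cong (4 ^ r ℕ.*_) (^-*-assoc 4 3 (m / 3)) ⟩
    4 ^ r ℕ.* 4 ^ (3 ℕ.* (m / 3))   ≡⟨ cong (λ k → 4 ^ r ℕ.* 4 ^ k) (*-comm 3 (m / 3)) ⟩
    4 ^ r ℕ.* 4 ^ (m / 3 ℕ.* 3)     ≡⟨ ^-distribˡ-+-* 4 r (m / 3 ℕ.* 3) ⟨
    4 ^ (r + m / 3 ℕ.* 3)           ≡⟨ cong (4 ^_) m≡ ⟨
    4 ^ m                           ≡⟨ e₄ ⟩
    1 + t ℕ.* 3                     ≡⟨ cong suc e₉ ⟩
    1 + c ℕ.* 9                     ∎
  -- The factor 1 + 63s is 1 modulo 9, so m ≡ 1 and m ≡ 2 modulo 3 leave the remainders 4 and 16 - 9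
  -- = 7 instead of 1.
  residue-1 : ∀ s → 4 + s ℕ.* 28 ℕ.* 9 ≡ 4 ℕ.* (1 + s ℕ.* 63)
  residue-1 = solve-∀
  residue-2 : ∀ s → 7 + (1 + s ℕ.* 112) ℕ.* 9 ≡ 16 ℕ.* (1 + s ℕ.* 63)
  residue-2 = solve-∀
  rearrange : ∀ f q → f + q ℕ.* 2 ℕ.* 3 ≡ q ℕ.* 3 ℕ.* 2 + f
  rearrange = solve-∀
  by-residue : ∀ r → r < 3 → m ≡ r + m / 3 ℕ.* 3 → f % 3 ≡ (m ℕ.* 2 + f) % 3
  by-residue 0 _ m≡ = begin
    f % 3                             ≡⟨ [m+kn]%n≡m%n f (m / 3 ℕ.* 2) 3 ⟨
    (f + m / 3 ℕ.* 2 ℕ.* 3) % 3       ≡⟨ cong (_% 3) (rearrange f (m / 3)) ⟩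
    (m / 3 ℕ.* 3 ℕ.* 2 + f) % 3       ≡⟨ cong (λ k → (k ℕ.* 2 + f) % 3) m≡ ⟨
    (m ℕ.* 2 + f) % 3                 ∎
  by-residue 1 _ m≡ = contradiction
    (residue-≡ {4} {1} 9 (s ℕ.* 28) c (trans (residue-1 s) (4^m 1 m≡))) λ ()
  by-residue 2 _ m≡ = contradiction
    (residue-≡ {7} {1} 9 (1 + s ℕ.* 112) c (trans (residue-2 s) (4^m 2 m≡))) λ ()
  by-residue (suc (suc (suc _))) (s≤s (s≤s (s≤s ()))) _

-- If m ≥ g + 2, then 2f + 3 = 4g + 5 ≤ 2m + f. If m ≤ g + 1, put a = 2^(2g): the hypothesis gives
-- 3(2a - 1) ≤ 4a - 1, so a ≤ 1 and g = 0.
v≡3⊎f+f+3≤v : ∀ m g {N L} → 0 < m → suc N ≡ 2 ^ suc (g ℕ.* 2) → suc L ≡ 2 ^ (m ℕ.* 2) → N ℕ.* 3 ≤ L →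
  let f = suc (g ℕ.* 2) in (m ℕ.* 2 + f ≡ 3) ⊎ (f + f + 3 ≤ m ℕ.* 2 + f)
v≡3⊎f+f+3≤v m g {N} {L} 0<m eN eL N*3≤L with m ≤? suc g
... | no m≰1+g = inj₂ (begin
    f + f + 3             ≡⟨ shape g ⟩
    (2 + g) ℕ.* 2 + f     ≤⟨ +-monoˡ-≤ f (*-monoˡ-≤ 2 (≰⇒> m≰1+g)) ⟩
    m ℕ.* 2 + f           ∎)
  where
  open ≤-Reasoning
  f = suc (g ℕ.* 2)
  shape : ∀ g → suc (g ℕ.* 2) + suc (g ℕ.* 2) + 3 ≡ (2 + g) ℕ.* 2 + suc (g ℕ.* 2)
  shape = solve-∀
... | yes m≤1+g with g
-- Here f = 1 and m = 1, which is the exceptional case v = 3.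
...   | zero = inj₁ (cong (λ k → k ℕ.* 2 + 1) (≤-antisym m≤1+g 0<m))
...   | suc g = contradiction (begin-strict
    a ℕ.* 6               ≡⟨ six a ⟩
    a ℕ.* 2 ℕ.* 3         ≡⟨ cong (ℕ._* 3) (trans (*-comm a 2) (sym eN)) ⟩
    suc N ℕ.* 3           ≡⟨⟩
    3 + N ℕ.* 3           ≤⟨ +-monoʳ-≤ 3 N*3≤L ⟩
    2 + suc L             ≡⟨ cong (2 +_) eL ⟩
    2 + 2 ^ (m ℕ.* 2)     ≤⟨ +-monoʳ-≤ 2 (^-monoʳ-≤ 2 (*-monoˡ-≤ 2 m≤1+g)) ⟩
    2 + 2 ^ ((2 + g) ℕ.* 2) ≡⟨ cong (2 +_) (four a) ⟩
    2 + a ℕ.* 4           <⟨ +-monoˡ-< (a ℕ.* 4) (≤-trans (s≤s (s≤s (s≤s z≤n))) (*-monoˡ-≤ 2 2≤a)) ⟩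
    a ℕ.* 2 + a ℕ.* 4     ≡⟨ *-distribˡ-+ a 2 4 ⟨
    a ℕ.* 6               ∎) (n≮n _)
  where
  open ≤-Reasoning
  a = 2 ^ (suc g ℕ.* 2)
  2≤a : 2 ≤ a
  2≤a = ^-monoʳ-≤ 2 {1} {suc g ℕ.* 2} (s≤s z≤n)
  six : ∀ a → a ℕ.* 6 ≡ a ℕ.* 2 ℕ.* 3
  six = solve-∀
  four : ∀ a → 2 ℕ.* (2 ℕ.* a) ≡ a ℕ.* 4
  four = solve-∀

-- Transfer to the standard matrix and conclusion.

theorem10-decomposed : ∀ m f (D : Sub (m ℕ.* 2 + f) → Set) (A : Mat (m ℕ.* 2 + f)) →
  IsSTS2 (m ℕ.* 2 + f) D → IsAut D A → A * (A * A) ≡ I → f < m ℕ.* 2 + f →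
  Conjugate A (typeMat (m ℕ.* 2 + f) f) →
  let v = m ℕ.* 2 + f in (f % 3 ≢ 2) × (f % 3 ≢ v % 3 → (v ≡ 3) ⊎ (f + f + 3 ≤ v))
theorem10-decomposed m f D A sts aut A³≡I f<v (P , Q , PQ≡I , QP≡I , QAP≡T) =
  42∣pairs⇒f%3≢2 {f} (trans (length-∖ fixedVectors-unique 0∈fixed) length-fixed)
    (length-distinctPairs (∖-unique fixedVectors-unique)) 42∣fixedPairs ,
  second
  where
  v : ℕ
  v = m ℕ.* 2 + f

  σ φ ψ : Vect v → Vect v
  σ x = x · A
  φ x = x · Q
  ψ x = x · P

  ψφ : ∀ x → ψ (φ x) ≡ x
  ψφ x = trans (sym (·-* x Q P)) (trans (cong (x ·_) QP≡I) (·-I x))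

  φψ : ∀ x → φ (ψ x) ≡ x
  φψ x = trans (sym (·-* x P Q)) (trans (cong (x ·_) PQ≡I) (·-I x))

  -- `ψ` is the change of coordinates that turns σ into the standard action: on row vectors,
  -- (zP)(QAP) = zAP.
  act-ψ : ∀ z → act m (ψ z) ≡ ψ (σ z)
  act-ψ z = begin
    act m (ψ z)               ≡⟨ ·-typeMat m (ψ z) ⟨
    ψ z · typeMat v f         ≡⟨ cong (ψ z ·_) QAP≡T ⟨
    ψ z · (Q * (A * P))       ≡⟨ ·-* (ψ z) Q (A * P) ⟩
    φ (ψ z) · (A * P)         ≡⟨ cong (_· (A * P)) (φψ z) ⟩
    z · (A * P)               ≡⟨ ·-* z A P ⟩
    ψ (σ z)                   ∎
    where open ≡-Reasoning

  σ³ : ∀ x → σ (σ (σ x)) ≡ x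
  σ³ x = begin
    σ (σ (σ x))         ≡⟨ ·-* (σ x) A A ⟨
    σ x · (A * A)       ≡⟨ ·-* x A (A * A) ⟨
    x · (A * (A * A))   ≡⟨ cong (x ·_) A³≡I ⟩
    x · I               ≡⟨ ·-I x ⟩
    x                   ∎
    where open ≡-Reasoning

  S : Steiner σ
  S = steiner sts aut λ {x} {y} e → trans (sym (σ³ x)) (trans (cong (σ ∘ σ) e) (σ³ y))

  open OrderThree σ (combo-⊕ A) σ³ S
  open Steiner S using (blk)
  open Counting (_≟ᵥ_ {v})
  open DecMembership (_≟ᵥ_ {v}) using (_∈?_)
  module CountW = Counting (_≟ᵥ_ {m ℕ.* 2})

  -- `φ ∘ embedFix m` is a bijection from the vectors of length `f` onto F.
  length-fixed : length fixedVectors ≡ 2 ^ f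
  length-fixed = trans (unique-⊑⊒⇒length-≡ fixedVectors-unique
      (Uniq.map⁺ injective (allVect-unique f)) to from)
    (trans (length-map _ (allVect f)) (length-allVect f))
    where
    injective : ∀ {x y} → φ (embedFix m x) ≡ φ (embedFix m y) → x ≡ y
    injective e = embedFix-injective m (trans (sym (ψφ _)) (trans (cong ψ e) (ψφ _)))
    to : ∀ {z} → z ∈ fixedVectors → z ∈ map (φ ∘ embedFix m) (allVect f)
    to {z} z∈ =
      let fz = proj₂ (∈-filter⁻ fixed? {xs = allVect v} z∈)
          y , e = act-fixed m (ψ z) (trans (act-ψ z) (cong ψ fz))
      in subst (_∈ _) (trans (cong φ (sym e)) (φψ z)) (∈-map⁺ (φ ∘ embedFix m) (∈-allVect y))
    from : ∀ {z} → z ∈ map (φ ∘ embedFix m) (allVect f) → z ∈ fixedVectors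
    from {z} z∈ with ∈-map⁻ (φ ∘ embedFix m) {xs = allVect f} z∈
    ... | y , _ , refl = ∈-filter⁺ fixed? (∈-allVect _) (begin
      σ (φ x)         ≡⟨ φψ _ ⟨
      φ (ψ (σ (φ x))) ≡⟨ cong φ (act-ψ (φ x)) ⟨
      φ (act m (ψ (φ x))) ≡⟨ cong (φ ∘ act m) (ψφ x) ⟩
      φ (act m x)     ≡⟨ cong φ (act-embedFix m y) ⟩
      φ x             ∎)
      where
      open ≡-Reasoning
      x = embedFix m y

  0∈fixed : zeroV ∈ fixedVectors
  0∈fixed = ∈-filter⁺ fixed? (∈-allVect zeroV) σ-0

  -- In the coordinates given by `ψ`, vectors of W vanish on the last `f` places, which leaves
  -- 2^(2m) - 1 nonzero candidates.
  ws : List (Vect v)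
  ws = map (φ ∘ embedW m) (allVect (m ℕ.* 2) CountW.∖ zeroV)

  length-ws : suc (length ws) ≡ 2 ^ (m ℕ.* 2)
  length-ws = trans (cong suc (length-map (φ ∘ embedW m) (allVect (m ℕ.* 2) CountW.∖ zeroV)))
    (trans (CountW.length-∖ (allVect-unique (m ℕ.* 2)) (∈-allVect zeroV)) (length-allVect (m ℕ.* 2)))

  ws-covers : ∀ {z} → InW z → z ≢ zeroV → z ∈ ws
  ws-covers {z} z∈W z≢0 with act-W m (ψ z) (begin
      act m (act m (ψ z))   ≡⟨ cong (act m) (act-ψ z) ⟩
      act m (ψ (σ z))       ≡⟨ act-ψ (σ z) ⟩
      ψ (σ (σ z))           ≡⟨ cong ψ z∈W ⟩
      ψ (z ⊕ σ z)           ≡⟨ combo-⊕ P z (σ z) ⟩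
      ψ z ⊕ ψ (σ z)         ≡⟨ cong (ψ z ⊕_) (act-ψ z) ⟨
      ψ z ⊕ act m (ψ z)     ∎)
    where open ≡-Reasoning
  ... | y , e = subst (_∈ ws) z≡ (∈-map⁺ (φ ∘ embedW m) (CountW.∈-∖⁺ (∈-allVect y) y≢0))
    where
    z≡ : φ (embedW m y) ≡ z
    z≡ = trans (cong φ (sym e)) (φψ z)
    y≢0 : y ≢ zeroV
    y≢0 refl = z≢0 (trans (sym z≡) (trans (cong φ (embedW-0 m)) (additive-0 (combo-⊕ Q))))

  nonzero : ∀ {n} → 0 < n → ∃ λ (p : Vect n) → p ≢ zeroV
  nonzero (s≤s _) = true ∷ zeroV , λ ()

  -- `f < v` makes `v` positive and so provides a nonzero `p` to count around.
  v-odd : ∃ λ h → v ≡ suc (h ℕ.* 2)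
  v-odd with nonzero (≤-trans (s≤s z≤n) f<v)
  ... | p , p≢0 = 6∣2^v∸2⇒odd (6∣nonzero∖p p≢0) (trans
    (cong suc (length-∖ (∖-unique (allVect-unique v)) (∈-∖⁺ (∈-allVect p) p≢0)))
    (trans (length-∖ (allVect-unique v) (∈-allVect zeroV)) (length-allVect v)))

  f-odd : ∃ λ g → f ≡ suc (g ℕ.* 2)
  f-odd with even⊎odd f | v-odd
  ... | inj₂ odd | _ = odd
  ... | inj₁ (g , f≡) | h , v≡ = contradiction
    (residue-≡ {0} {1} 2 (m + g) h (trans (*-distribʳ-+ 2 m g) (trans (cong (m ℕ.* 2 +_) (sym f≡)) v≡)))
    λ ()

  0<m : ∀ m → f < m ℕ.* 2 + f → 0 < m
  0<m zero f<f = contradiction f<f (n≮n f)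
  0<m (suc _) _ = s≤s z≤n

  second : f % 3 ≢ v % 3 → (v ≡ 3) ⊎ (f + f + 3 ≤ v)
  second f≢v with f-odd
  ... | g , f≡ = subst (λ f′ → (m ℕ.* 2 + f′ ≡ 3) ⊎ (f′ + f′ + 3 ≤ m ℕ.* 2 + f′)) (sym f≡)
    (v≡3⊎f+f+3≤v m g (0<m m f<v)
      (trans (trans (length-∖ fixedVectors-unique 0∈fixed) length-fixed) (cong (2 ^_) f≡))
      length-ws (fixed∖0*3≤ ws-covers invariant))
    where
    invariant : ∀ {p} → p ≢ zeroV → Fixed p → ∃ λ x → ¬ Fixed x × σ x ∈ blk p x
    -- A finite search decides whether some sextuple at `p` is kept by σ. If none is, the moved
    -- vectors come in eighteens, which forces f ≡ v modulo 3.
    invariant {p} p≢0 fp with Any.any? (λ x → ¬? (fixed? x) ×-dec (σ x ∈? blk p x)) (allVect v)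
    ... | yes found = satisfied found
    ... | no none = contradiction (18∣2^v∸2^f⇒≡ m {f} counts
        (18∣movedVectors p≢0 fp λ mx σx∈ → none (lose (∈-allVect _) (mx , σx∈)))) f≢v
      where
      counts : 2 ^ f + length movedVectors ≡ 2 ^ v
      counts = trans (cong (_+ length movedVectors) (sym length-fixed))
        (trans (length-filter-¬ fixed? (allVect v)) (length-allVect v))

theorem10 : (v : ℕ) (D : Sub v → Set) (A : Mat v) →
    IsSTS2 v D → IsAut D A → HasOrder3 A →
    (f : ℕ) → f < v → 2 ∣ (v ∸ f) → Conjugate A (typeMat v f) →
    (f % 3 ≢ 2) × (f % 3 ≢ v % 3 → (v ≡ 3) ⊎ (f + f + 3 ≤ v))
theorem10 v D A sts aut (_ , _ , A³≡I) f f<v (divides m v∸f≡) conj =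
  transport (trans (sym (m∸n+n≡m (<⇒≤ f<v))) (cong (_+ f) v∸f≡)) D A sts aut A³≡I f<v conj
  where
  -- With `v` generalised, matching on `refl` retypes `D`, `A` and all hypotheses at `m ℕ.* 2 + f`,
  -- where `act` can recurse on `m`.
  transport : ∀ {v} → v ≡ m ℕ.* 2 + f → (D : Sub v → Set) (A : Mat v) → IsSTS2 v D → IsAut D A →
    A * (A * A) ≡ I → f < v → Conjugate A (typeMat v f) →
    (f % 3 ≢ 2) × (f % 3 ≢ v % 3 → (v ≡ 3) ⊎ (f + f + 3 ≤ v))
  transport refl = theorem10-decomposed m f
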